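{- Let $G$ be an ordered abelian group with bounded regular rank. Then $G$ admits quantifier elimination in the language $$L=\{+,-,0,\le\}\cup\{1_\Delta : \Delta\in\mathrm{RJ}(G),\ G/\Delta\text{ discrete}\}\cup\{x\equiv y \bmod \Delta : \Delta\in\mathrm{RJ}(G)\}\cup\{x\equiv y \bmod (\Delta+p^mG): p\text{ prime},\ \Delta\in\mathrm{RJ}_p(G),\ m\ge1\},$$ where each $1_\Delta$ is a constant interpreted as an element of $G$ whose image in $G/\Delta$ is the smallest positive element of $G/\Delta$, and $x\equiv y\bmod H$ is the binary relation $x-y\in H$.
   Context: An ordered abelian group (OAG) is an abelian group with a translation-invariant linear order. For $n\ge 2$, an OAG $H$ is $n$-regular if $H/C$ is $n$-divisible for every convex subgroup $C\neq\{0\}$ of $H$. For $g\in G\setminus\{0\}$, $B(g)$ is the smallest convex subgroup of $G$ containing $g$ and $A_n(g)$ is the smallest convex subgroup $C\subseteq B(g)$ of $G$ such that $B(g)/C$ is $n$-regular. $\mathrm{RJ}_n(G)=\{A_n(g): g\in G\setminus\{0\}\}$ and $\mathrm{RJ}(G)=\bigcup_{n\ge2}\mathrm{RJ}_n(G)$. $G$ has bounded regular rank if $\mathrm{RJ}_p(G)$ is finite for every prime $p$. -}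

module Defs where

open import Level using (0ℓ) renaming (suc to lsuc)
open import Data.Nat using (ℕ; zero; suc; _^_) renaming (_≤_ to _≤ℕ_)
open import Data.Nat.Primality using (Prime)
open import Data.Fin using (Fin) renaming (zero to fz; suc to fs)
open import Data.Product using (Σ; ∃; ∃-syntax; _×_; _,_; proj₁)
open import Data.Sum using (_⊎_)
open import Data.Empty using (⊥)
open import Relation.Nullary using (¬_)
open import Relation.Binary.PropositionalEquality using (_≡_; _≢_)
open import Algebra.Structures using (IsAbelianGroup)
open import Relation.Binary.Structures using (IsTotalOrder)

record OAG : Set₁ where
  infixl 6 _+_
  infix 4 _≤_
  field
    Carrier        : Set
    _+_            : Carrier → Carrier → Carrier
    -_             : Carrier → Carrier
    0#             : Carrier
    _≤_            : Carrier → Carrier → Set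
    isAbelianGroup : IsAbelianGroup _≡_ _+_ 0# -_
    isTotalOrder   : IsTotalOrder _≡_ _≤_
    +-monoʳ        : ∀ {x y} z → x ≤ y → z + x ≤ z + y

module _ (G : OAG) where
  open OAG G

  _-_ : Carrier → Carrier → Carrier
  x - y = x + (- y)

  _·_ : ℕ → Carrier → Carrier
  zero  · x = 0#
  suc n · x = x + (n · x)

  Subset : Set₁
  Subset = Carrier → Set

  _⊆_ : Subset → Subset → Set
  C ⊆ D = ∀ x → C x → D x

  _≐_ : Subset → Subset → Set
  C ≐ D = (C ⊆ D) × (D ⊆ C)

  record IsConvexSubgroup (C : Subset) : Set where
    field
      has-0   : C 0#
      has-+   : ∀ x y → C x → C y → C (x + y)
      has-neg : ∀ x → C x → C (- x)
      convex  : ∀ a x b → C a → C b → a ≤ x → x ≤ b → C x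

  IsB : Carrier → Subset → Set₁
  IsB g B = IsConvexSubgroup B × B g
            × (∀ C → IsConvexSubgroup C → C g → B ⊆ C)

  QuotDivisible : ℕ → Subset → Subset → Set
  QuotDivisible n D B = ∀ h → B h → ∃[ h' ] (B h' × D (h - (n · h')))

  -- For convex subgroups C ⊆ B of G, "B/C is n-regular": for every
  -- nonzero convex subgroup of B/C (= D/C with C ⊊ D ⊆ B, D convex
  -- in G), the quotient (B/C)/(D/C) ≅ B/D is n-divisible.
  Regular : ℕ → Subset → Subset → Set₁
  Regular n C B = ∀ D → IsConvexSubgroup D → C ⊆ D → D ⊆ B
                  → (∃[ x ] (D x × ¬ C x)) → QuotDivisible n D B

  IsA : ℕ → Carrier → Subset → Set₁
  IsA n g A = Σ Subset λ B → IsB g B × IsConvexSubgroup A × A ⊆ B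
              × Regular n A B
              × (∀ C → IsConvexSubgroup C → C ⊆ B → Regular n C B → A ⊆ C)

  RJ : ℕ → Subset → Set₁
  RJ n Δ = ∃[ g ] (g ≢ 0# × IsA n g Δ)

  InRJ : Subset → Set₁
  InRJ Δ = ∃[ n ] (2 ≤ℕ n × RJ n Δ)

  BoundedRegularRank : Set₁
  BoundedRegularRank = ∀ p → Prime p →
    ∃[ k ] Σ (Fin k → Subset) λ f → ∀ Δ → RJ p Δ → ∃[ i ] (Δ ≐ f i)

  -- order of G/Δ (Δ convex): [a] ≤ [b] iff a ≤ b or a - b ∈ Δ
  QLe : Subset → Carrier → Carrier → Set
  QLe Δ a b = (a ≤ b) ⊎ Δ (a - b)

  IsLeastPos : Subset → Carrier → Set
  IsLeastPos Δ e = ¬ Δ e × QLe Δ 0# e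
                   × (∀ x → ¬ Δ x → QLe Δ 0# x → QLe Δ e x)

  DiscreteQuot : Subset → Set
  DiscreteQuot Δ = ∃[ e ] IsLeastPos Δ e

  ConstIx : Set₁
  ConstIx = Σ Subset λ Δ → InRJ Δ × DiscreteQuot Δ

  ModIx : Set₁
  ModIx = Σ Subset InRJ

  ModPIx : Set₁
  ModPIx = Σ ℕ λ p → Prime p × Σ ℕ λ m → 1 ≤ℕ m × Σ Subset (RJ p)

  data Term (n : ℕ) : Set₁ where
    var  : Fin n → Term n
    zer  : Term n
    plus : Term n → Term n → Term n
    neg  : Term n → Term n
    one  : ConstIx → Term n

  data Formula : ℕ → Set₁ where
    _≈ᶠ_   : ∀ {n} → Term n → Term n → Formula n
    _≤ᶠ_   : ∀ {n} → Term n → Term n → Formula n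
    modΔ   : ∀ {n} → ModIx → Term n → Term n → Formula n
    modP   : ∀ {n} → ModPIx → Term n → Term n → Formula n
    ⊥ᶠ     : ∀ {n} → Formula n
    _⇒ᶠ_   : ∀ {n} → Formula n → Formula n → Formula n
    _∧ᶠ_   : ∀ {n} → Formula n → Formula n → Formula n
    _∨ᶠ_   : ∀ {n} → Formula n → Formula n → Formula n
    ∃ᶠ     : ∀ {n} → Formula (suc n) → Formula n
    ∀ᶠ     : ∀ {n} → Formula (suc n) → Formula n

  data QF : ∀ {n} → Formula n → Set₁ where
    qf-≈  : ∀ {n} (t s : Term n) → QF (t ≈ᶠ s)
    qf-≤  : ∀ {n} (t s : Term n) → QF (t ≤ᶠ s)
    qf-mΔ : ∀ {n} i (t s : Term n) → QF (modΔ i t s)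
    qf-mP : ∀ {n} i (t s : Term n) → QF (modP i t s)
    qf-⊥  : ∀ {n} → QF (⊥ᶠ {n})
    qf-⇒  : ∀ {n} {φ ψ : Formula n} → QF φ → QF ψ → QF (φ ⇒ᶠ ψ)
    qf-∧  : ∀ {n} {φ ψ : Formula n} → QF φ → QF ψ → QF (φ ∧ᶠ ψ)
    qf-∨  : ∀ {n} {φ ψ : Formula n} → QF φ → QF ψ → QF (φ ∨ᶠ ψ)

  extend : ∀ {n} → Carrier → (Fin n → Carrier) → Fin (suc n) → Carrier
  extend a v fz     = a
  extend a v (fs i) = v i

  module Semantics (oneI : ConstIx → Carrier) where
    eval : ∀ {n} → Term n → (Fin n → Carrier) → Carrier
    eval (var i)    v = v i
    eval zer        v = 0#
    eval (plus t s) v = eval t v + eval s v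
    eval (neg t)    v = - eval t v
    eval (one c)    v = oneI c

    Sat : ∀ {n} → Formula n → (Fin n → Carrier) → Set
    Sat (t ≈ᶠ s) v = eval t v ≡ eval s v
    Sat (t ≤ᶠ s) v = eval t v ≤ eval s v
    Sat (modΔ (Δ , _) t s) v = Δ (eval t v - eval s v)
    Sat (modP (p , _ , m , _ , Δ , _) t s) v =
      ∃[ d ] ∃[ z ] (Δ d × (eval t v - eval s v) ≡ d + ((p ^ m) · z))
    Sat ⊥ᶠ v = ⊥
    Sat (φ ⇒ᶠ ψ) v = Sat φ v → Sat ψ v
    Sat (φ ∧ᶠ ψ) v = Sat φ v × Sat ψ v
    Sat (φ ∨ᶠ ψ) v = Sat φ v ⊎ Sat ψ v
    Sat (∃ᶠ φ) v = ∃[ a ] Sat φ (extend a v)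
    Sat (∀ᶠ φ) v = ∀ a → Sat φ (extend a v)

  QE : (ConstIx → Carrier) → Set₁
  QE oneI = ∀ n (φ : Formula n) → Σ (Formula n) λ ψ → QF ψ ×
            (∀ v → (Sat φ v → Sat ψ v) × (Sat ψ v → Sat φ v))
    where open Semantics oneI

-- If the truth values of finitely many quantifier-free formulas at v and v′ always decide
-- whether P v implies P v′, then P is a Boolean combination of these formulas. So for
-- P v = ∃ x. φ(x, v) it suffices to transfer a given solution x over v to a solution x′
-- over every v′ that agrees with v on a suitable finite set of formulas.
--
-- After replacing x by a multiple, φ only compares x with finitely many points t b, in the
-- order modulo the convex subgroups of a finite chain and modulo D + qG for D in the chain
-- and q | Q. The chain contains RJ_p for all p | Q. The element x′ is found by descending
-- this chain. Let D ⊂ X be consecutive and let x′ be correct modulo X. If x = t b + c·1_D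
-- modulo D with c ≤ Q, take t′ b + c·1_D. Otherwise first correct x′ by elements of X so
-- that its congruences modulo D + qG become right, one prime power at a time: since the
-- distances of the t′ b agree with those of the t b, counting classes shows that some class
-- is available. Then move x′ by Q·X into the right interval between the t′ b modulo D. This
-- is possible because X/D is p-regular for every p | Q (no A_p(h) lies strictly between D
-- and X), and because the interval is longer than Q·e for some e > 0 in X/D: if G/D is
-- discrete then e = 1_D works, since x is far from all t b.

module Submission where

open import Defs
open import Level using (0ℓ; Lift; lift; lower) renaming (suc to lsuc)
open import Axiom.ExcludedMiddle using (ExcludedMiddle)
open import Data.Product using (Σ; ∃-syntax; _×_; _,_; proj₁; proj₂)
open import Algebra.Structures using (IsAbelianGroup)
open import Data.Empty using (⊥; ⊥-elim)
open import Data.Fin as Fin using (Fin) renaming (zero to fz; suc to fs)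
import Data.Fin.Properties as Finₚ
open import Data.Integer as ℤ using (ℤ; -[1+_])
import Data.Integer.Properties as ℤₚ
open import Data.List using (List; []; _∷_; _++_; map; length; lookup)
open import Data.List.Membership.Propositional using (_∈_; find)
open import Data.List.Membership.Propositional.Properties using (∈-map⁺; ∈-map⁻; ∈-++⁺ˡ; ∈-++⁺ʳ)
open import Data.List.Relation.Unary.All as All using (All; []; _∷_)
import Data.List.Relation.Unary.All.Properties as Allₚ
open import Data.List.Relation.Unary.AllPairs using (AllPairs; []; _∷_)
open import Data.List.Relation.Unary.Any as Any using (Any; here; there)
import Data.List.Relation.Unary.Any.Properties as Anyₚ
open import Data.Nat as ℕ using (ℕ; zero; suc; _^_; NonZero; s≤s)
open import Data.Nat.Coprimality using (Coprime; coprime-divisor; coprime-Bézout)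
open import Data.Nat.Divisibility
open import Data.Nat.DivMod using (_/_; m/n*n≡m)
open import Data.Nat.GCD using (module Bézout)
open import Data.Nat.Induction using (<-rec)
open import Data.Nat.ListAction using (product)
open import Data.Nat.Primality using
  (Prime; prime?; prime[2]; ¬prime[1]; euclidsLemma; prime⇒irreducible; prime⇒nonZero; prime⇒nonTrivial;
      productOfPrimes≢0)
open import Data.Nat.Primality.Factorisation using (PrimeFactorisation; factorise)
import Data.Nat.Properties as ℕₚ
open import Data.Sum using (_⊎_; inj₁; inj₂)
open import Data.Unit using (⊤; tt)
open import Data.Vec as Vec using (Vec; []; _∷_)
open import Relation.Binary.Definitions using (Total; Transitive; tri<; tri≈; tri>)
open import Relation.Binary.PropositionalEquality
import Relation.Binary.Reflection as Reflection
open import Relation.Binary.Structures using (IsTotalOrder)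
open import Relation.Nullary using (¬_; Dec; yes; no; contradiction)
open import Relation.Nullary.Decidable using (map′; True; toWitness; fromWitness; decidable-stable)

-- Prime powers

-- The language has congruences only for prime powers with Δ in RJ_p, and constants only for Δ in
-- RJ(G), while the chain may hold any convex subgroup. So it has to be shown that D + qG is
-- definable for every convex D, and that a discrete quotient G/D puts D into RJ_2, which makes 1_D
-- available.
--
-- Replacing x by a multiple N x creates an obligation: the point found over v′ must again be
-- divisible by N. That is one more congruence, modulo N at the subgroup 0 and relative to the point
-- 0, and for this reason 0 is put among the points and {0} into the chain. Scaling a condition by k
-- turns a modulus q into kq, so Q is a common multiple of N and of all these products.
--
-- A point t b + c·1_D chosen at D must also stand correctly at every larger subgroup of the chain.
-- It is the value of a term, so its relations to all t b at all subgroups can be put into the list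
-- of formulas; the bound c ≤ Q keeps this list finite.

prime∣^⇒prime∣ : ∀ {r n} → Prime r → ∀ a → r ∣ n ^ a → r ∣ n
prime∣^⇒prime∣ pr zero r∣1 =
  contradiction (subst Prime (∣1⇒≡1 r∣1) pr) ¬prime[1]
prime∣^⇒prime∣ {r} {n} pr (suc a) r∣ with euclidsLemma n (n ^ a) pr r∣
... | inj₁ h = h
... | inj₂ h = prime∣^⇒prime∣ pr a h

prime∣prime⇒≡ : ∀ {r p} → Prime r → Prime p → r ∣ p → r ≡ p
prime∣prime⇒≡ pr pp r∣p with prime⇒irreducible pp r∣p
... | inj₁ refl = contradiction pr ¬prime[1]
... | inj₂ eq   = eq

hasPrimeFactor : ∀ n → n ≢ 1 → ∃[ r ] (Prime r × r ∣ n)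
hasPrimeFactor zero _ = 2 , prime[2] , (2 ∣0)
hasPrimeFactor n@(suc _) n≢1 with factorise n
... | record { factors = [] ; isFactorisation = eq } = contradiction eq n≢1
... | record { factors = r ∷ rs ; isFactorisation = eq ; factorsPrime = pr ∷ _ } =
  r , pr , subst (r ∣_) (sym eq) (m∣m*n (product rs))

¬commonPrime⇒coprime : ∀ m n → (∀ {r} → Prime r → r ∣ m → ¬ (r ∣ n)) → Coprime m n
¬commonPrime⇒coprime m n h {d} (d∣m , d∣n) with d ℕ.≟ 1
... | yes eq = eq
... | no neq with hasPrimeFactor d neq
...   | r , pr , r∣d = contradiction (∣-trans r∣d d∣n) (h pr (∣-trans r∣d d∣m))

primePower-coprime : ∀ {p R} → Prime p → ¬ (p ∣ R) → ∀ a → Coprime (p ^ a) R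
primePower-coprime {p} {R} pp p∤R a = ¬commonPrime⇒coprime (p ^ a) R λ pr r∣pᵃ r∣R →
  p∤R (subst (_∣ R) (prime∣prime⇒≡ pr pp (prime∣^⇒prime∣ pr a r∣pᵃ)) r∣R)

splitPrimePower : ∀ {p} → Prime p → ∀ q → .{{NonZero q}} →
                  ∃[ a ] ∃[ R ] (q ≡ p ^ a ℕ.* R × ¬ (p ∣ R))
splitPrimePower {p} pp = <-rec _ step
  where
  step : ∀ q → (∀ {r} → r ℕ.< q → .{{NonZero r}} → ∃[ a ] ∃[ R ] (r ≡ p ^ a ℕ.* R × ¬ (p ∣ R))) →
         .{{NonZero q}} → ∃[ a ] ∃[ R ] (q ≡ p ^ a ℕ.* R × ¬ (p ∣ R))
  step q rec with p ∣? q
  ... | no p∤q = 0 , q , sym (ℕₚ.*-identityˡ q) , p∤q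
  ... | yes p∣q
    with rec {quotient p∣q} (quotient-< p∣q {{prime⇒nonTrivial pp}}) {{quotient≢0 p∣q}}
  ...   | a , R , eq , p∤R = suc a , R
    , trans (m∣n⇒n≡m*quotient p∣q) (trans (cong (p ℕ.*_) eq) (sym (ℕₚ.*-assoc p (p ^ a) R))) , p∤R

-- For r different from p, the power r^m is coprime to the extra factor p; for r = p only the
-- exponent a + 1 is new, as a larger one would force p to divide R. Hence `matchPrime` has a single
-- new congruence to arrange when q grows to p q.
primePower∣p*q : ∀ {p a R} → Prime p → ¬ (p ∣ R) → ∀ {r} → Prime r → ∀ m →
                 r ^ m ∣ p ℕ.* (p ^ a ℕ.* R) → r ^ m ∣ p ^ a ℕ.* R ⊎ (r ≡ p × m ≡ suc a)
primePower∣p*q {p} {a} {R} pp p∤R {r} pr m d with r ℕ.≟ p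
... | no r≢p = inj₁ (coprime-divisor
        (primePower-coprime pr (λ r∣p → r≢p (prime∣prime⇒≡ pr pp r∣p)) m) d)
... | yes refl with ℕₚ.<-cmp m (suc a)
...   | tri< (s≤s m≤a) _ _ = inj₁ (∣-trans (m≤n⇒m^n∣o m≤a) (m∣m*n R))
  where
  m≤n⇒m^n∣o : ∀ {m n} → m ℕ.≤ n → p ^ m ∣ p ^ n
  m≤n⇒m^n∣o {m} {n} h = divides (p ^ (n ℕ.∸ m))
    (trans (cong (p ^_) (sym (ℕₚ.m∸n+n≡m h))) (ℕₚ.^-distribˡ-+-* p (n ℕ.∸ m) m))
...   | tri≈ _ eq _ = inj₂ (refl , eq)
...   | tri> _ _ a<m = contradiction
          (*-cancelˡ-∣ (p ^ suc a) {{ℕₚ.m^n≢0 p (suc a) {{prime⇒nonZero pp}}}} d′) p∤R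
  where
  d′ : p ^ suc a ℕ.* p ∣ p ^ suc a ℕ.* R
  d′ = subst₂ _∣_ (ℕₚ.*-comm p (p ^ suc a)) (sym (ℕₚ.*-assoc p (p ^ a) R))
       (∣-trans (divides (p ^ (m ℕ.∸ suc (suc a)))
         (trans (cong (p ^_) (sym (ℕₚ.m∸n+n≡m a<m))) (ℕₚ.^-distribˡ-+-* p (m ℕ.∸ suc (suc a)) (suc (suc a))))) d)

-- Each step splits off the full power of a prime, so that the two factors are coprime and
-- `CG-coprime-⇔` applies.
primePower-induction : ∀ {ℓ} (P : ℕ → Set ℓ) → P 1 →
  (∀ {p} a R → Prime p → ¬ (p ∣ R) → P R → P (p ^ suc a ℕ.* R)) →
  ∀ q → .{{NonZero q}} → P q
primePower-induction P P1 Pstep = <-rec _ step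
  where
  step : ∀ q → (∀ {r} → r ℕ.< q → .{{NonZero r}} → P r) → .{{NonZero q}} → P q
  step q rec with q ℕ.≟ 1
  ... | yes refl = P1
  ... | no q≢1 with hasPrimeFactor q q≢1
  ...   | p , pp , p∣q with splitPrimePower pp q
  ...     | zero , R , eq , p∤R = contradiction (subst (p ∣_) (trans eq (ℕₚ.*-identityˡ R)) p∣q) p∤R
  ...     | suc a , R , refl , p∤R = Pstep a R pp p∤R
              (rec (subst (R ℕ.<_) (ℕₚ.*-comm R (p ^ suc a)) (ℕₚ.m<m*n R (p ^ suc a) {{R≢0}} (ℕₚ.≤-trans
                  (ℕ.nonTrivial⇒n>1 p {{prime⇒nonTrivial pp}}) (ℕₚ.m≤m*n p
                  (p ^ a) {{ℕₚ.m^n≢0 p a {{prime⇒nonZero pp}}}})))) {{R≢0}})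
    where
    R≢0 : NonZero R
    R≢0 = ℕₚ.m*n≢0⇒n≢0 (p ^ suc a)

-- Zero entries are passed over: they are the coefficients of conditions from which the eliminated
-- variable is absent, and they must not make the multiple zero.
commonMultiple : (ns : List ℕ) → ∃[ N ] (NonZero N × All (λ n → n ≢ 0 → n ∣ N) ns)
commonMultiple [] = 1 , _ , []
commonMultiple (zero ∷ ns) with commonMultiple ns
... | N , nz , h = N , nz , (λ z → contradiction refl z) ∷ h
commonMultiple (n@(suc _) ∷ ns) with commonMultiple ns
... | N , nz , h = n ℕ.* N , ℕₚ.m*n≢0 n N {{_}} {{nz}} , (λ _ → m∣m*n N) ∷ All.map (λ f z → ∣n⇒∣m*n n (f z)) h

module _ (em : ExcludedMiddle (lsuc 0ℓ)) (G : OAG) where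

  open OAG G
  open IsAbelianGroup isAbelianGroup using ()
    renaming (assoc to +-assoc; comm to +-comm; identityˡ to +-identityˡ; identityʳ to +-identityʳ
             ; inverseˡ to +-inverseˡ; inverseʳ to +-inverseʳ)

  infixl 6 _−_
  _−_ : Carrier → Carrier → Carrier
  x − y = x + - y

  infixr 7 _⊙_
  _⊙_ : ℕ → Carrier → Carrier
  _⊙_ = _·_ G

  -- Multiples, and a solver for identities in abelian groups

  +-interchange : ∀ a b c d → (a + b) + (c + d) ≡ (a + c) + (b + d)
  +-interchange a b c d = begin
    (a + b) + (c + d) ≡⟨ +-assoc a b (c + d) ⟩
    a + (b + (c + d)) ≡⟨ cong (a +_) (sym (+-assoc b c d)) ⟩
    a + ((b + c) + d) ≡⟨ cong (λ z → a + (z + d)) (+-comm b c) ⟩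
    a + ((c + b) + d) ≡⟨ cong (a +_) (+-assoc c b d) ⟩
    a + (c + (b + d)) ≡⟨ sym (+-assoc a c (b + d)) ⟩
    (a + c) + (b + d) ∎
    where open ≡-Reasoning

  +-cancelʳ : ∀ {a b} c → a + c ≡ b + c → a ≡ b
  +-cancelʳ {a} {b} c eq = trans (sym (cancel a)) (trans (cong (_− c) eq) (cancel b))
    where
    cancel : ∀ x → (x + c) − c ≡ x
    cancel x = trans (+-assoc x c (- c)) (trans (cong (x +_) (+-inverseʳ c)) (+-identityʳ x))

  -‿unique : ∀ a b → a + b ≡ 0# → a ≡ - b
  -‿unique a b eq = +-cancelʳ b (trans eq (sym (+-inverseˡ b)))

  -‿+ : ∀ a b → - (a + b) ≡ - a + - b
  -‿+ a b = sym (-‿unique (- a + - b) (a + b) (trans (+-interchange (- a) (- b) a b)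
    (trans (cong₂ _+_ (+-inverseˡ a) (+-inverseˡ b)) (+-identityˡ 0#))))

  -‿invol : ∀ a → - (- a) ≡ a
  -‿invol a = sym (-‿unique a (- a) (+-inverseʳ a))

  -0≡0 : - 0# ≡ 0#
  -0≡0 = sym (-‿unique 0# 0# (+-identityˡ 0#))

  ⊙-+ : ∀ n a b → n ⊙ (a + b) ≡ n ⊙ a + n ⊙ b
  ⊙-+ zero a b = sym (+-identityˡ 0#)
  ⊙-+ (suc n) a b = trans (cong ((a + b) +_) (⊙-+ n a b)) (+-interchange a b (n ⊙ a) (n ⊙ b))

  ⊙-- : ∀ n a → n ⊙ (- a) ≡ - (n ⊙ a)
  ⊙-- zero a = sym -0≡0
  ⊙-- (suc n) a = trans (cong (- a +_) (⊙-- n a)) (sym (-‿+ a (n ⊙ a)))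

  ⊙-− : ∀ n a b → n ⊙ (a − b) ≡ n ⊙ a − n ⊙ b
  ⊙-− n a b = trans (⊙-+ n a (- b)) (cong (n ⊙ a +_) (⊙-- n b))

  +-⊙ : ∀ m n a → (m ℕ.+ n) ⊙ a ≡ m ⊙ a + n ⊙ a
  +-⊙ zero n a = sym (+-identityˡ (n ⊙ a))
  +-⊙ (suc m) n a = trans (cong (a +_) (+-⊙ m n a)) (sym (+-assoc a (m ⊙ a) (n ⊙ a)))

  *-⊙ : ∀ m n a → (m ℕ.* n) ⊙ a ≡ m ⊙ (n ⊙ a)
  *-⊙ zero n a = refl
  *-⊙ (suc m) n a = trans (+-⊙ n (m ℕ.* n) a) (cong (n ⊙ a +_) (*-⊙ m n a))

  ⊙-0 : ∀ n → n ⊙ 0# ≡ 0#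
  ⊙-0 zero = refl
  ⊙-0 (suc n) = trans (+-identityˡ (n ⊙ 0#)) (⊙-0 n)

  ⊙-comm : ∀ m n a → m ⊙ (n ⊙ a) ≡ n ⊙ (m ⊙ a)
  ⊙-comm m n a = trans (sym (*-⊙ m n a)) (trans (cong (_⊙ a) (ℕₚ.*-comm m n)) (*-⊙ n m a))

  1-⊙ : ∀ a → 1 ⊙ a ≡ a
  1-⊙ a = +-identityʳ a

  _⊙ℤ_ : ℤ → Carrier → Carrier
  (ℤ.+ n)    ⊙ℤ a = n ⊙ a
  -[1+ n ] ⊙ℤ a = - (suc n ⊙ a)

  ⊖-⊙ℤ : ∀ m n a → (m ℤ.⊖ n) ⊙ℤ a ≡ m ⊙ a − n ⊙ a
  ⊖-⊙ℤ m zero a = sym (trans (cong (m ⊙ a +_) -0≡0) (+-identityʳ (m ⊙ a)))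
  ⊖-⊙ℤ zero (suc n) a = sym (+-identityˡ _)
  ⊖-⊙ℤ (suc m) (suc n) a = begin
    (suc m ℤ.⊖ suc n) ⊙ℤ a             ≡⟨ cong (_⊙ℤ a) (ℤₚ.[1+m]⊖[1+n]≡m⊖n m n) ⟩
    (m ℤ.⊖ n) ⊙ℤ a                     ≡⟨ ⊖-⊙ℤ m n a ⟩
    m ⊙ a − n ⊙ a                      ≡⟨ sym (+-identityˡ _) ⟩
    0# + (m ⊙ a − n ⊙ a)               ≡⟨ cong (_+ (m ⊙ a − n ⊙ a)) (sym (+-inverseʳ a)) ⟩
    (a − a) + (m ⊙ a − n ⊙ a)          ≡⟨ +-interchange a (- a) (m ⊙ a) (- (n ⊙ a)) ⟩
    (a + m ⊙ a) + (- a + - (n ⊙ a))    ≡⟨ cong ((a + m ⊙ a) +_) (sym (-‿+ a (n ⊙ a))) ⟩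
    (a + m ⊙ a) − (a + n ⊙ a)          ∎
    where open ≡-Reasoning

  +-⊙ℤ : ∀ i j a → (i ℤ.+ j) ⊙ℤ a ≡ i ⊙ℤ a + j ⊙ℤ a
  +-⊙ℤ (ℤ.+ m) (ℤ.+ n) a = +-⊙ m n a
  +-⊙ℤ (ℤ.+ m) -[1+ n ] a = ⊖-⊙ℤ m (suc n) a
  +-⊙ℤ -[1+ m ] (ℤ.+ n) a = trans (⊖-⊙ℤ n (suc m) a) (+-comm _ _)
  +-⊙ℤ -[1+ m ] -[1+ n ] a = begin
    - (suc (suc (m ℕ.+ n)) ⊙ a)       ≡⟨ cong (λ k → - (suc k ⊙ a)) (sym (ℕₚ.+-suc m n)) ⟩
    - ((suc m ℕ.+ suc n) ⊙ a)         ≡⟨ cong -_ (+-⊙ (suc m) (suc n) a) ⟩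
    - (suc m ⊙ a + suc n ⊙ a)         ≡⟨ -‿+ (suc m ⊙ a) (suc n ⊙ a) ⟩
    - (suc m ⊙ a) + - (suc n ⊙ a)     ∎
    where open ≡-Reasoning

  -⊙ℤ : ∀ i a → (ℤ.- i) ⊙ℤ a ≡ - (i ⊙ℤ a)
  -⊙ℤ (ℤ.+ zero) a = sym -0≡0
  -⊙ℤ (ℤ.+ suc n) a = refl
  -⊙ℤ -[1+ n ] a = sym (-‿invol _)

  -- The normal form is the vector of integer coefficients. These compute, so `refl` settles an
  -- identity. A multiple `n ⊙ a` with variable n is opaque and has to be passed in as an atom.
  module Solver where
    infixl 6 _:+_ _:-_
    infix 8 :-_
    data Expr (n : ℕ) : Set where
      :var : Fin n → Expr n
      :0   : Expr n
      _:+_ : Expr n → Expr n → Expr n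
      :-_  : Expr n → Expr n

    _:-_ : ∀ {n} → Expr n → Expr n → Expr n
    a :- b = a :+ (:- b)

    ⟦_⟧ : ∀ {n} → Expr n → Vec Carrier n → Carrier
    ⟦ :var i ⟧ ρ = Vec.lookup ρ i
    ⟦ :0 ⟧ ρ = 0#
    ⟦ a :+ b ⟧ ρ = ⟦ a ⟧ ρ + ⟦ b ⟧ ρ
    ⟦ :- a ⟧ ρ = - ⟦ a ⟧ ρ

    unit : ∀ {n} → Fin n → Vec ℤ n
    unit fz = (ℤ.+ 1) ∷ Vec.replicate _ (ℤ.+ 0)
    unit (fs i) = (ℤ.+ 0) ∷ unit i

    coefficients : ∀ {n} → Expr n → Vec ℤ n
    coefficients (:var i) = unit i
    coefficients :0 = Vec.replicate _ (ℤ.+ 0)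
    coefficients (a :+ b) = Vec.zipWith ℤ._+_ (coefficients a) (coefficients b)
    coefficients (:- a) = Vec.map ℤ.-_ (coefficients a)

    combination : ∀ {n} → Vec ℤ n → Vec Carrier n → Carrier
    combination [] [] = 0#
    combination (z ∷ zs) (a ∷ ρ) = z ⊙ℤ a + combination zs ρ

    ⟦_⇓⟧ : ∀ {n} → Expr n → Vec Carrier n → Carrier
    ⟦ e ⇓⟧ ρ = combination (coefficients e) ρ

    combination-0 : ∀ {n} (ρ : Vec Carrier n) → combination (Vec.replicate n (ℤ.+ 0)) ρ ≡ 0#
    combination-0 [] = refl
    combination-0 (a ∷ ρ) = trans (+-identityˡ _) (combination-0 ρ)

    combination-unit : ∀ {n} (i : Fin n) ρ → combination (unit i) ρ ≡ Vec.lookup ρ i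
    combination-unit fz (a ∷ ρ) = trans (cong₂ _+_ (1-⊙ a) (combination-0 ρ)) (+-identityʳ a)
    combination-unit (fs i) (a ∷ ρ) = trans (+-identityˡ _) (combination-unit i ρ)

    combination-+ : ∀ {n} (zs ws : Vec ℤ n) ρ →
      combination (Vec.zipWith ℤ._+_ zs ws) ρ ≡ combination zs ρ + combination ws ρ
    combination-+ [] [] [] = sym (+-identityˡ 0#)
    combination-+ (z ∷ zs) (w ∷ ws) (a ∷ ρ) =
      trans (cong₂ _+_ (+-⊙ℤ z w a) (combination-+ zs ws ρ)) (+-interchange _ _ _ _)

    combination-neg : ∀ {n} (zs : Vec ℤ n) ρ → combination (Vec.map ℤ.-_ zs) ρ ≡ - combination zs ρ
    combination-neg [] [] = sym -0≡0
    combination-neg (z ∷ zs) (a ∷ ρ) =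
      trans (cong₂ _+_ (-⊙ℤ z a) (combination-neg zs ρ)) (sym (-‿+ _ _))

    correct : ∀ {n} (e : Expr n) ρ → ⟦ e ⇓⟧ ρ ≡ ⟦ e ⟧ ρ
    correct (:var i) ρ = combination-unit i ρ
    correct :0 ρ = combination-0 ρ
    correct (a :+ b) ρ = trans (combination-+ (coefficients a) (coefficients b) ρ)
        (cong₂ _+_ (correct a ρ) (correct b ρ))
    correct (:- a) ρ = trans (combination-neg (coefficients a) ρ) (cong -_ (correct a ρ))

    open Reflection (setoid Carrier) :var ⟦_⟧ ⟦_⇓⟧ correct public using (solve; _⊜_)

  open Solver public using (solve; _⊜_; _:+_; _:-_; :-_; :0)

  open IsTotalOrder isTotalOrder using ()
    renaming (refl to ≤-refl; trans to ≤-trans; antisym to ≤-antisym; total to ≤-total; reflexive to ≤-reflexive)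

  -- Convex subgroups, the order of G/D and congruences modulo D + qG

  Sub : Set₁
  Sub = Subset G

  Convex : Sub → Set
  Convex = IsConvexSubgroup G

  dec : (A : Set) → Dec A
  dec A = map′ lower lift (em {Lift (lsuc 0ℓ) A})

  byContradiction : ∀ {A : Set} → ¬ ¬ A → A
  byContradiction {A} = decidable-stable (dec A)

  ¬∀⇒∃¬ : ∀ {A B : Carrier → Set} → ¬ (∀ x → A x → B x) → ∃[ x ] (A x × ¬ B x)
  ¬∀⇒∃¬ h = byContradiction λ k → h λ x a → byContradiction λ nb → k (x , a , nb)

  -- Excluded middle makes every proposition in Set₁ equivalent to one in Set, which
  -- is how subgroups defined by quantifying over all subgroups become a Subset.
  Resize : Set₁ → Set
  Resize P = True (em {P})

  resize : ∀ {P} → P → Resize P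
  resize = fromWitness

  unresize : ∀ {P} → Resize P → P
  unresize = toWitness

  infix 3 _⇔_
  _⇔_ : ∀ {a b} → Set a → Set b → Set (a Level.⊔ b)
  A ⇔ B = (A → B) × (B → A)

  ⇔-sym : ∀ {a b} {A : Set a} {B : Set b} → A ⇔ B → B ⇔ A
  ⇔-sym (f , g) = g , f

  ⇔-trans : ∀ {a b c} {A : Set a} {B : Set b} {C : Set c} → A ⇔ B → B ⇔ C → A ⇔ C
  ⇔-trans (f , g) (h , k) = (λ a → h (f a)) , (λ c → g (k c))

  ⇔-conj : ∀ {a b c d} {A : Set a} {B : Set b} {C : Set c} {D : Set d} → A ⇔ B → C ⇔ D → (A × C) ⇔ (B × D)
  ⇔-conj (f , g) (h , k) = (λ (a , c) → f a , h c) , (λ (b , d) → g b , k d)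

  ⇔-refl : ∀ {a} {A : Set a} → A ⇔ A
  ⇔-refl = (λ a → a) , (λ a → a)

  -- An inequality depends only on the difference of its sides, which leaves an identity for the
  -- solver. `⊑-shift` and `⊏-shift` do the same in G/D.
  ≤-shift : ∀ {a b a′ b′} → a ≤ b → b − a ≡ b′ − a′ → a′ ≤ b′
  ≤-shift {a} {b} {a′} {b′} a≤b eq = subst₂ _≤_
    (solve 2 (λ a a′ → (a′ :- a) :+ a ⊜ a′) refl a a′)
    (trans (solve 3 (λ a b a′ → (a′ :- a) :+ b ⊜ a′ :+ (b :- a)) refl a b a′)
      (trans (cong (a′ +_) eq) (solve 2 (λ a′ b′ → a′ :+ (b′ :- a′) ⊜ b′) refl a′ b′)))
    (+-monoʳ (a′ − a) a≤b)

  neg-antitone : ∀ {a b} → a ≤ b → - b ≤ - a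
  neg-antitone {a} {b} a≤b = ≤-shift a≤b (solve 2 (λ a b → b :- a ⊜ :- a :- :- b) refl a b)

  ≤0⇒0≤- : ∀ {a} → a ≤ 0# → 0# ≤ - a
  ≤0⇒0≤- {a} h = ≤-shift h (solve 1 (λ a → :0 :- a ⊜ :- a :- :0) refl a)

  Full : Sub
  Full _ = ⊤

  Full-convex : Convex Full
  Full-convex = record
    { has-0 = tt ; has-+ = λ _ _ _ _ → tt ; has-neg = λ _ _ → tt ; convex = λ _ _ _ _ _ _ _ → tt }

  Zero : Sub
  Zero x = x ≡ 0#

  Zero-convex : Convex Zero
  Zero-convex = record
    { has-0 = refl
    ; has-+ = λ _ _ x≡0 y≡0 → trans (cong₂ _+_ x≡0 y≡0) (+-identityˡ 0#)
    ; has-neg = λ _ x≡0 → trans (cong -_ x≡0) -0≡0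
    ; convex = λ a x b a≡0 b≡0 a≤x x≤b → ≤-antisym (subst (x ≤_) b≡0 x≤b) (subst (_≤ x) a≡0 a≤x)
    }

  -- Congruence modulo D + qG, as a record rather than a Σ-type so that D, q and u can be
  -- inferred from it.
  record CG (D : Sub) (q : ℕ) (u : Carrier) : Set where
    constructor _,_
    field
      multiplier : Carrier
      remainder  : D (u − q ⊙ multiplier)

  -- G/D is never formed: its order is a total preorder on representatives, and equality in it is
  -- membership of the difference in D.
  module Quotient (D : Sub) (cD : Convex D) where
    open IsConvexSubgroup cD public

    infix 4 _⊑_ _⊏_
    _⊑_ : Carrier → Carrier → Set
    x ⊑ y = QLe G D x y

    _⊏_ : Carrier → Carrier → Set
    x ⊏ y = ¬ (y ⊑ x)

    has-− : ∀ {x y} → D x → D y → D (x − y)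
    has-− dx dy = has-+ _ _ dx (has-neg _ dy)

    has-−-swap : ∀ {x y} → D (x − y) → D (y − x)
    has-−-swap {x} {y} d = subst D (solve 2 (λ x y → :- (x :- y) ⊜ y :- x) refl x y) (has-neg _ d)

    has-−-trans : ∀ {x y z} → D (x − y) → D (y − z) → D (x − z)
    has-−-trans {x} {y} {z} d e = subst D (solve 3 (λ x y z → (x :- y) :+ (y :- z) ⊜ x :- z) refl x y z) (has-+ _ _ d e)

    has-−-refl : ∀ {x} → D (x − x)
    has-−-refl {x} = subst D (sym (+-inverseʳ x)) has-0

    has-⊙ : ∀ n {x} → D x → D (n ⊙ x)
    has-⊙ zero d = has-0
    has-⊙ (suc n) d = has-+ _ _ d (has-⊙ n d)

    ∈⇒⊑ : ∀ {x y} → D (x − y) → x ⊑ y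
    ∈⇒⊑ = inj₂

    ∈⇒⊒ : ∀ {x y} → D (x − y) → y ⊑ x
    ∈⇒⊒ d = inj₂ (has-−-swap d)

    ⊑-refl : ∀ {x} → x ⊑ x
    ⊑-refl = inj₁ ≤-refl

    ⊑-shift : ∀ {a b a′ b′} → a ⊑ b → b − a ≡ b′ − a′ → a′ ⊑ b′
    ⊑-shift (inj₁ h) eq = inj₁ (≤-shift h eq)
    ⊑-shift {a} {b} {a′} {b′} (inj₂ d) eq = inj₂ (has-−-swap (subst D eq (has-−-swap d)))

    -- x ≤ z fails only if z ≤ x, and then x − z is squeezed into D.
    ⊑-trans : ∀ {x y z} → x ⊑ y → y ⊑ z → x ⊑ z
    ⊑-trans {x} {y} {z} (inj₁ p) (inj₁ q) = inj₁ (≤-trans p q)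
    ⊑-trans {x} {y} {z} (inj₁ x≤y) (inj₂ d) with ≤-total x z
    ... | inj₁ h = inj₁ h
    ... | inj₂ z≤x = inj₂ (convex 0# _ (y − z) has-0 d
      (≤-shift z≤x (solve 2 (λ x z → x :- z ⊜ (x :- z) :- :0) refl x z))
      (≤-shift x≤y (solve 3 (λ x y z → y :- x ⊜ (y :- z) :- (x :- z)) refl x y z)))
    ⊑-trans {x} {y} {z} (inj₂ d) (inj₁ y≤z) with ≤-total x z
    ... | inj₁ h = inj₁ h
    ... | inj₂ z≤x = inj₂ (convex 0# _ (x − y) has-0 d
      (≤-shift z≤x (solve 2 (λ x z → x :- z ⊜ (x :- z) :- :0) refl x z))
      (≤-shift y≤z (solve 3 (λ x y z → z :- y ⊜ (x :- y) :- (x :- z)) refl x y z)))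
    ⊑-trans (inj₂ d) (inj₂ e) = inj₂ (has-−-trans d e)

    ⊑-total : ∀ x y → x ⊑ y ⊎ y ⊑ x
    ⊑-total x y with ≤-total x y
    ... | inj₁ h = inj₁ (inj₁ h)
    ... | inj₂ h = inj₂ (inj₁ h)

    ⊏⇒⊑ : ∀ {x y} → x ⊏ y → x ⊑ y
    ⊏⇒⊑ {x} {y} h with ⊑-total x y
    ... | inj₁ p = p
    ... | inj₂ q = contradiction q h

    ⊑-⊏-trans : ∀ {x y z} → x ⊑ y → y ⊏ z → x ⊏ z
    ⊑-⊏-trans p h q = h (⊑-trans q p)

    ⊏-⊑-trans : ∀ {x y z} → x ⊏ y → y ⊑ z → x ⊏ z
    ⊏-⊑-trans h p q = h (⊑-trans p q)

    ⊏-shift : ∀ {a b a′ b′} → a ⊏ b → b − a ≡ b′ − a′ → a′ ⊏ b′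
    ⊏-shift {a} {b} {a′} {b′} h eq q = h (⊑-shift q
      (trans (solve 2 (λ a b → a :- b ⊜ :- (b :- a)) refl a′ b′)
      (trans (cong -_ (sym eq)) (solve 2 (λ a b → :- (b :- a) ⊜ a :- b) refl a b))))

    ⊑-antisym : ∀ {x y} → x ⊑ y → y ⊑ x → D (x − y)
    ⊑-antisym {x} {y} (inj₁ p) (inj₁ q) = subst (λ z → D (x − z)) (≤-antisym p q) has-−-refl
    ⊑-antisym (inj₂ d) _ = d
    ⊑-antisym _ (inj₂ e) = has-−-swap e

    ⊑∧∉⇒⊏ : ∀ {x y} → x ⊑ y → ¬ D (x − y) → x ⊏ y
    ⊑∧∉⇒⊏ p n q = n (⊑-antisym p q)

    ⊑-+ : ∀ {a b c d} → a ⊑ b → c ⊑ d → a + c ⊑ b + d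
    ⊑-+ {a} {b} {c} {d} p q = ⊑-trans
      (⊑-shift p (solve 3 (λ a b c → b :- a ⊜ (b :+ c) :- (a :+ c)) refl a b c))
      (⊑-shift q (solve 3 (λ b c d → d :- c ⊜ (b :+ d) :- (b :+ c)) refl b c d))

    ⊑-⊏-+ : ∀ {a b c d} → a ⊑ b → c ⊏ d → a + c ⊏ b + d
    ⊑-⊏-+ {a} {b} {c} {d} p q = ⊑-⊏-trans
      (⊑-shift p (solve 3 (λ a b c → b :- a ⊜ (b :+ c) :- (a :+ c)) refl a b c))
      (⊏-shift q (solve 3 (λ b c d → d :- c ⊜ (b :+ d) :- (b :+ c)) refl b c d))

    ⊑-neg : ∀ {a b} → a ⊑ b → - b ⊑ - a
    ⊑-neg {a} {b} p = ⊑-shift p (solve 2 (λ a b → b :- a ⊜ :- a :- :- b) refl a b)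

    ⊑-⊙ : ∀ n {a b} → a ⊑ b → n ⊙ a ⊑ n ⊙ b
    ⊑-⊙ zero p = ⊑-refl
    ⊑-⊙ (suc n) p = ⊑-+ p (⊑-⊙ n p)

    0⊑⊙ : ∀ n {a} → 0# ⊑ a → 0# ⊑ n ⊙ a
    0⊑⊙ n {a} p = subst (_⊑ n ⊙ a) (⊙-0 n) (⊑-⊙ n p)

    ⊑-⊙-self : ∀ n → .{{NonZero n}} → ∀ {a} → 0# ⊑ a → a ⊑ n ⊙ a
    ⊑-⊙-self (suc n) {a} p = ⊑-trans (inj₁ (≤-reflexive (sym (+-identityʳ a)))) (⊑-+ ⊑-refl (0⊑⊙ n p))

    ⊑-⊙-monoˡ : ∀ {m n a} → m ℕ.≤ n → 0# ⊑ a → m ⊙ a ⊑ n ⊙ a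
    ⊑-⊙-monoˡ {n = n} ℕ.z≤n p = 0⊑⊙ n p
    ⊑-⊙-monoˡ (ℕ.s≤s h) p = ⊑-+ ⊑-refl (⊑-⊙-monoˡ h p)

    -- G/D is torsion-free by convexity: up to sign 0 ≤ x, and then x lies between 0 and n x.
    ∈-⊙⁻ : ∀ n → .{{NonZero n}} → ∀ {x} → D (n ⊙ x) → D x
    ∈-⊙⁻ n {x} d with ≤-total 0# x
    ... | inj₁ 0≤x = subst D (solve 1 (λ x → x :- :0 ⊜ x) refl x)
          (⊑-antisym (⊑-trans (⊑-⊙-self n (inj₁ 0≤x)) (inj₂ (subst D (solve 1 (λ y → y ⊜ y :- :0) refl
              (n ⊙ x)) d))) (inj₁ 0≤x))
    ... | inj₂ x≤0 = subst D (solve 1 (λ x → :- (:- x) ⊜ x) refl x)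
        (has-neg _ (subst D (solve 1 (λ x → (:- x) :- :0 ⊜ :- x) refl x)
          (⊑-antisym (⊑-trans (⊑-⊙-self n (inj₁ (≤0⇒0≤- x≤0)))
            (inj₂ (subst D (trans (sym (⊙-- n x)) (solve 1 (λ y → y ⊜ y :- :0) refl (n ⊙ (- x)))) (has-neg _ d))))
                (inj₁ (≤0⇒0≤- x≤0)))))

    ⊑-⊙⁻ : ∀ n → .{{NonZero n}} → ∀ {a b} → n ⊙ a ⊑ n ⊙ b → a ⊑ b
    ⊑-⊙⁻ n {a} {b} h with ⊑-total a b
    ... | inj₁ p = p
    ... | inj₂ q = inj₂ (∈-⊙⁻ n (subst D (sym (⊙-− n a b)) (⊑-antisym h (⊑-⊙ n q))))

    ⊑-⊙-⇔ : ∀ n → .{{NonZero n}} → ∀ {a b} → (a ⊑ b) ⇔ (n ⊙ a ⊑ n ⊙ b)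
    ⊑-⊙-⇔ n = ⊑-⊙ n , ⊑-⊙⁻ n

    CG-mod : ∀ {q u w} → D (u − w) → CG D q u → CG D q w
    CG-mod {q} {u} {w} d (z , e) = z , has-−-trans (has-−-swap d) e

    ∈⇒CG : ∀ {q u} → D u → CG D q u
    ∈⇒CG {q} {u} d = 0# , subst D (trans (solve 1 (λ u → u ⊜ u :- :0) refl u) (cong (u −_) (sym (⊙-0 q)))) d

    CG-+ : ∀ {q u w} → CG D q u → CG D q w → CG D q (u + w)
    CG-+ {q} {u} {w} (z , d) (z′ , d′) = z + z′ , subst D
      (trans (solve 4 (λ u w a b → (u :- a) :+ (w :- b) ⊜ (u :+ w) :- (a :+ b)) refl u w (q ⊙ z) (q ⊙ z′))
        (cong ((u + w) −_) (sym (⊙-+ q z z′)))) (has-+ _ _ d d′)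

    CG-neg : ∀ {q u} → CG D q u → CG D q (- u)
    CG-neg {q} {u} (z , d) = - z , subst D
      (trans (solve 2 (λ u a → :- (u :- a) ⊜ :- u :- :- a) refl u (q ⊙ z)) (cong (- u −_) (sym (⊙-- q z))))
          (has-neg _ d)

    CG-⊙ : ∀ q z → CG D q (q ⊙ z)
    CG-⊙ q z = z , has-−-refl

    CG-1 : ∀ u → CG D 1 u
    CG-1 u = u , subst (λ w → D (u − w)) (sym (1-⊙ u)) has-−-refl

    CG-∣ : ∀ {q q′ u} → q′ ∣ q → CG D q u → CG D q′ u
    CG-∣ {q} {q′} {u} (divides k eq) (z , d) = k ⊙ z , subst (λ w → D (u − w))
      (trans (cong (_⊙ z) (trans eq (ℕₚ.*-comm k q′))) (*-⊙ q′ k z)) d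

    -- Torsion-freeness of G/D gives the way back. This is what allows all conditions on x to be
    -- scaled to one common multiple of x.
    CG-scale : ∀ k → .{{NonZero k}} → ∀ {q u} → CG D q u ⇔ CG D (k ℕ.* q) (k ⊙ u)
    CG-scale k {q} {u} = (λ (z , d) → z , subst D (eq z) (has-⊙ k d))
                       , (λ (z , d) → z , ∈-⊙⁻ k (subst D (sym (eq z)) d))
      where
      eq : ∀ z → k ⊙ (u − q ⊙ z) ≡ k ⊙ u − (k ℕ.* q) ⊙ z
      eq z = trans (⊙-− k u (q ⊙ z)) (cong (k ⊙ u −_) (sym (*-⊙ k q z)))

    -- Write u as x a u - y b u. Modulo D the first term is a multiple of ab because u is a multiple
    -- of b, the second because u is a multiple of a.
    CG-bézout : ∀ {a b u} x y → 1 ℕ.+ y ℕ.* b ≡ x ℕ.* a → CG D a u → CG D b u → CG D (a ℕ.* b) u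
    CG-bézout {a} {b} {u} x y eq (w , d) (z , e) =
      x ⊙ z − y ⊙ w , subst D lem (has-− (has-⊙ (x ℕ.* a) e) (has-⊙ (y ℕ.* b) d))
      where
      open ≡-Reasoning
      Z = (a ℕ.* b) ⊙ (x ⊙ z)
      W = (a ℕ.* b) ⊙ (y ⊙ w)
      ab : ∀ n c → (n ℕ.* a) ⊙ (b ⊙ c) ≡ (a ℕ.* b) ⊙ (n ⊙ c)
      ab n c = trans (sym (*-⊙ (n ℕ.* a) b c)) (trans (cong (_⊙ c)
        (trans (ℕₚ.*-assoc n a b) (ℕₚ.*-comm n (a ℕ.* b)))) (*-⊙ (a ℕ.* b) n c))
      ba : ∀ n c → (n ℕ.* b) ⊙ (a ⊙ c) ≡ (a ℕ.* b) ⊙ (n ⊙ c)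
      ba n c = trans (sym (*-⊙ (n ℕ.* b) a c)) (trans (cong (_⊙ c)
        (trans (ℕₚ.*-assoc n b a) (trans (ℕₚ.*-comm n (b ℕ.* a)) (cong (ℕ._* n) (ℕₚ.*-comm b a))))) (*-⊙ (a ℕ.* b) n c))
      lem : (x ℕ.* a) ⊙ (u − b ⊙ z) − (y ℕ.* b) ⊙ (u − a ⊙ w) ≡ u − (a ℕ.* b) ⊙ (x ⊙ z − y ⊙ w)
      lem = begin
        (x ℕ.* a) ⊙ (u − b ⊙ z) − (y ℕ.* b) ⊙ (u − a ⊙ w)
          ≡⟨ cong₂ _−_ (trans (⊙-− (x ℕ.* a) u (b ⊙ z)) (cong ((x ℕ.* a) ⊙ u −_) (ab x z)))
                       (trans (⊙-− (y ℕ.* b) u (a ⊙ w)) (cong ((y ℕ.* b) ⊙ u −_) (ba y w))) ⟩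
        ((x ℕ.* a) ⊙ u − Z) − ((y ℕ.* b) ⊙ u − W)
          ≡⟨ cong (λ n → (n ⊙ u − Z) − ((y ℕ.* b) ⊙ u − W)) (sym eq) ⟩
        ((u + (y ℕ.* b) ⊙ u) − Z) − ((y ℕ.* b) ⊙ u − W)
          ≡⟨ solve 4 (λ u v Z W → ((u :+ v) :- Z) :- (v :- W) ⊜ u :- (Z :- W)) refl u ((y ℕ.* b) ⊙ u) Z W ⟩
        u − (Z − W)
          ≡⟨ cong (u −_) (sym (⊙-− (a ℕ.* b) (x ⊙ z) (y ⊙ w))) ⟩
        u − (a ℕ.* b) ⊙ (x ⊙ z − y ⊙ w) ∎

    CG-coprime : ∀ {a b u} → Coprime a b → CG D a u → CG D b u → CG D (a ℕ.* b) u
    CG-coprime {a} {b} {u} cop g h with coprime-Bézout cop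
    ... | Bézout.+- x y eq = CG-bézout x y eq g h
    ... | Bézout.-+ x y eq = subst (λ n → CG D n u) (ℕₚ.*-comm b a) (CG-bézout y x eq h g)

  ⊆-⊑ : ∀ {D X : Sub} {x y} → (∀ u → D u → X u) → QLe G D x y → QLe G X x y
  ⊆-⊑ h (inj₁ p) = inj₁ p
  ⊆-⊑ h (inj₂ d) = inj₂ (h _ d)

  module _ {C D : Sub} (cC : Convex C) (cD : Convex D) where
    private
      module C = Quotient C cC
      module D = Quotient D cD

    ∃nonneg∉ : ∀ {x} → C x → ¬ D x → ∃[ a ] (0# ≤ a × C a × ¬ D a)
    ∃nonneg∉ {x} c n with ≤-total 0# x
    ... | inj₁ h = x , h , c , n
    ... | inj₂ h = - x , ≤0⇒0≤- h , C.has-neg _ c , λ d → n (subst D (-‿invol x) (D.has-neg _ d))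

    -- A nonnegative element of C outside D exceeds every element of D in absolute value. Convex
    -- subgroups therefore form a chain under inclusion.
    ∃∉⇒⊆ : ∀ {x} → C x → ¬ D x → ∀ y → D y → C y
    ∃∉⇒⊆ {x} c n y d with ∃nonneg∉ c n
    ... | a , 0≤a , ca , na with ≤-total 0# y
    ...   | inj₁ 0≤y with ≤-total a y
    ...     | inj₁ a≤y = contradiction (D.convex _ _ _ D.has-0 d 0≤a a≤y) na
    ...     | inj₂ y≤a = C.convex _ _ _ C.has-0 ca 0≤y y≤a
    ∃∉⇒⊆ {x} c n y d | a , 0≤a , ca , na | inj₂ y≤0 with ≤-total a (- y)
    ...     | inj₁ a≤-y = contradiction (D.convex _ _ _ D.has-0 (D.has-neg _ d) 0≤a a≤-y) na
    ...     | inj₂ -y≤a = subst C (-‿invol y) (C.has-neg _ (C.convex _ _ _ C.has-0 ca (≤0⇒0≤- y≤0) -y≤a))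

    ⊈⇒⊇ : ¬ (_⊆_ G C D) → _⊆_ G D C
    ⊈⇒⊇ h with ¬∀⇒∃¬ h
    ... | x , c , n = ∃∉⇒⊆ c n

  infix 4 _⊆′_
  _⊆′_ : Sub → Sub → Set
  _⊆′_ = _⊆_ G

  ⊆-trans : ∀ {C D E : Sub} → C ⊆′ D → D ⊆′ E → C ⊆′ E
  ⊆-trans f g x c = g x (f x c)

  -- The subgroups A_n(g)

  B : Carrier → Sub
  B g x = Resize (∀ C → Convex C → C g → C x)

  B-convex : ∀ g → Convex (B g)
  B-convex g = record
    { has-0 = resize λ C cC Cg → IsConvexSubgroup.has-0 cC
    ; has-+ = λ x y bx by → resize λ C cC Cg → IsConvexSubgroup.has-+ cC x y (unresize bx C cC Cg) (unresize by C cC Cg)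
    ; has-neg = λ x bx → resize λ C cC Cg → IsConvexSubgroup.has-neg cC x (unresize bx C cC Cg)
    ; convex = λ a x b ba bb p q → resize λ C cC Cg →
        IsConvexSubgroup.convex cC a x b (unresize ba C cC Cg) (unresize bb C cC Cg) p q
    }

  B-isB : ∀ g → IsB G g (B g)
  B-isB g = B-convex g , resize (λ C cC Cg → Cg) , λ C cC Cg x bx → unresize bx C cC Cg

  A : ℕ → Carrier → Sub
  A n g x = Resize (∀ C → Convex C → C ⊆′ B g → Regular G n C (B g) → C x)

  A-convex : ∀ n g → Convex (A n g)
  A-convex n g = record
    { has-0 = resize λ C cC s r → IsConvexSubgroup.has-0 cC
    ; has-+ = λ x y ax ay → resize λ C cC s r → IsConvexSubgroup.has-+ cC x y (unresize ax C cC s r)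
        (unresize ay C cC s r)
    ; has-neg = λ x ax → resize λ C cC s r → IsConvexSubgroup.has-neg cC x (unresize ax C cC s r)
    ; convex = λ a x b aa ab p q → resize λ C cC s r →
        IsConvexSubgroup.convex cC a x b (unresize aa C cC s r) (unresize ab C cC s r) p q
    }

  A⊆B : ∀ n g → A n g ⊆′ B g
  A⊆B n g x ax = unresize ax (B g) (B-convex g) (λ _ b → b) λ D cD s t (y , dy , nby) → contradiction (t y dy) nby

  ∉A : ∀ n {g x} → ¬ A n g x →
    Σ Sub λ C → Convex C × C ⊆′ B g × Regular G n C (B g) × ¬ C x
  ∉A n {g} {x} nax = decidable-stable em λ k → nax (resize λ C cC s r →
    byContradiction λ nc → k (C , cC , s , r , nc))

  -- The intersection inherits regularity: if D properly exceeds it, some C of the family misses an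
  -- element of D, so C lies properly in D by linearity, and regularity of B(g)/C applies to D.
  A-isA : ∀ n g → IsA G n g (A n g)
  A-isA n g = B g , B-isB g , A-convex n g , A⊆B n g , regular
    , λ C cC s r x ax → unresize ax C cC s r
    where
    regular : Regular G n (A n g) (B g)
    regular D cD A⊆D D⊆B (x , dx , nax) with ∉A n nax
    ... | C , cC , s , r , ncx = r D cD (∃∉⇒⊆ cD cC dx ncx) D⊆B (x , dx , ncx)

  -- For nonzero g this is the largest convex subgroup omitting g. As a union it is closed under
  -- addition because convex subgroups form a chain.
  V : Carrier → Sub
  V g x = Resize (Σ Sub λ C → Convex C × C x × ¬ C g)

  V-convex : ∀ {g} → g ≢ 0# → Convex (V g)
  V-convex {g} g≢0 = record
    { has-0 = resize (Zero , Zero-convex , refl , g≢0)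
    ; has-+ = λ x y vx vy → add x y (unresize vx) (unresize vy)
    ; has-neg = λ x vx → let (C , cC , cx , ncg) = unresize vx in
        resize (C , cC , IsConvexSubgroup.has-neg cC x cx , ncg)
    ; convex = λ a x b va vb p q → conv a x b p q (unresize va) (unresize vb)
    }
    where
    W : Carrier → Set₁
    W x = Σ Sub λ C → Convex C × C x × ¬ C g
    common : ∀ {x y} → W x → W y → Σ Sub λ C → Convex C × C x × C y × ¬ C g
    common {x} {y} (C , cC , cx , ncg) (D , cD , dy , ndg) with dec (C ⊆′ D)
    ... | yes s = D , cD , s x cx , dy , ndg
    ... | no n = C , cC , cx , ⊈⇒⊇ cC cD n y dy , ncg
    add : ∀ x y → W x → W y → V g (x + y)
    add x y wx wy with common wx wy
    ... | C , cC , cx , cy , ncg = resize (C , cC , IsConvexSubgroup.has-+ cC x y cx cy , ncg)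
    conv : ∀ a x b → a ≤ x → x ≤ b → W a → W b → V g x
    conv a x b p q wa wb with common wa wb
    ... | C , cC , ca , cb , ncg = resize (C , cC , IsConvexSubgroup.convex cC a x b ca cb p q , ncg)

  -- A nonzero convex subgroup of the archimedean quotient B(g)/V(g) is everything.
  V-regular : ∀ n {g X} → g ≢ 0# → IsB G g X → Regular G n (V g) X
  V-regular n {g} {X} g≢0 (cX , xg , leastX) D cD V⊆D D⊆X (x , dx , nvx) h xh with dec (D g)
  ... | no ndg = contradiction (resize (D , cD , dx , ndg)) nvx
  ... | yes dg = 0# , IsConvexSubgroup.has-0 cX , leastX D cD dg _
    (subst X (trans (solve 1 (λ h → h ⊜ h :- :0) refl h) (cong (h −_) (sym (⊙-0 n)))) xh)

  -- `V g` competes in the minimality of A_n(g), and it omits g. This keeps A_p(h) from containing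
  -- any subgroup to which h belongs.
  isA⇒∌ : ∀ n {g Y} → g ≢ 0# → IsA G n g Y → ¬ Y g
  isA⇒∌ n {g} {Y} g≢0 (X , isB@(cX , xg , leastX) , cY , Y⊆X , reg , least) yg with
    unresize (least (V g) (V-convex g≢0) V⊆X (V-regular n g≢0 isB) g yg)
    where
    V⊆X : V g ⊆′ X
    V⊆X x vx with unresize vx
    ... | C , cC , cx , ncg = ∃∉⇒⊆ cX cC xg ncg x cx
  ... | C , cC , cg , ncg = ncg cg

  -- If G/D has a least positive element e then B(e)/D ≅ ℤ is not 2-divisible, so D = A₂(e).
  discrete⇒RJ₂ : ∀ D → Convex D → ∀ e → IsLeastPos G D e → RJ G 2 D
  discrete⇒RJ₂ D cD e (nde , 0⊑e , leaste) = e , e≢0 , B e , B-isB e , cD , D⊆B , regular , least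
    where
    open Quotient D cD
    e≢0 : e ≢ 0#
    e≢0 eq = nde (subst D (sym eq) has-0)
    D⊆B : D ⊆′ B e
    D⊆B = ∃∉⇒⊆ (B-convex e) cD (proj₁ (proj₂ (B-isB e))) nde
    regular : Regular G 2 D (B e)
    regular E cE D⊆E E⊆B (x , ex , ndx) with ∃nonneg∉ cE cD ex ndx
    ... | a , 0≤a , ea , nda = λ h bh → 0# , IsConvexSubgroup.has-0 (B-convex e)
        , subst E (trans (solve 1 (λ h → h ⊜ h :- :0) refl h) (cong (h −_) (sym (⊙-0 2)))) (unresize bh E cE Ee)
      where
      -- Leastness gives e ⊑ a, so convexity brings e into E. Then E contains all of B(e), and 0
      -- serves as the quotient by 2.
      Ee : E e
      Ee with leaste a nda (inj₁ 0≤a)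
      ... | inj₂ d = subst E (solve 2 (λ e a → (e :- a) :+ a ⊜ e) refl e a) (IsConvexSubgroup.has-+ cE _ _ (D⊆E _ d) ea)
      ... | inj₁ e≤a with ≤-total 0# e
      ...   | inj₁ 0≤e = IsConvexSubgroup.convex cE _ _ _ (IsConvexSubgroup.has-0 cE) ea 0≤e e≤a
      ...   | inj₂ e≤0 = contradiction (subst D (solve 1 (λ e → e :- :0 ⊜ e) refl e) (⊑-antisym (inj₁ e≤0) 0⊑e)) nde
    least : ∀ C → Convex C → C ⊆′ B e → Regular G 2 C (B e) → D ⊆′ C
    least C cC C⊆B reg with dec (D ⊆′ C)
    ... | yes s = s
    ... | no n with ¬∀⇒∃¬ n
    ...   | y , dy , ncy with reg D cD (∃∉⇒⊆ cD cC dy ncy) D⊆B (y , dy , ncy) e (proj₁ (proj₂ (B-isB e)))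
    ...     | h , bh , d = contradiction e∈D nde
      where
      nh : ¬ D h
      nh dh = nde (subst D (solve 2 (λ e h → (e :- h) :+ h ⊜ e) refl e (2 ⊙ h)) (has-+ _ _ d (has-⊙ 2 dh)))
      -- Here e is 2h modulo D. If h is positive in G/D, then e ⊑ h and 2e ⊑ 2h ⊑ e; otherwise e ⊑
      -- 2h ⊑ 0.
      e⊑0 : e ⊑ 0#
      e⊑0 with ⊑-total 0# h
      ... | inj₁ 0⊑h = ⊑-shift (⊑-trans (⊑-⊙ 2 (leaste h nh 0⊑h)) (∈⇒⊒ d))
              (solve 1 (λ e → e :- (e :+ (e :+ :0)) ⊜ :0 :- e) refl e)
      ... | inj₂ h⊑0 = ⊑-trans (∈⇒⊑ d) (subst (2 ⊙ h ⊑_) (⊙-0 2) (⊑-⊙ 2 h⊑0))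
      e∈D : D e
      e∈D = subst D (solve 1 (λ e → e :- :0 ⊜ e) refl e) (⊑-antisym e⊑0 0⊑e)

  -- For h in X outside E, linearity places E properly above A_p(h) and inside B(h). Regularity of
  -- B(h)/A_p(h) then divides h by p modulo E, inside B(h) and hence inside X.
  regular-cover : ∀ p {X E} → Convex X → Convex E → E ⊆′ X →
    (∀ h → h ≢ 0# → X h → ¬ E h → ¬ (E ⊆′ A p h)) →
    QuotDivisible G p E X
  regular-cover p {X} {E} cX cE E⊆X hyp h xh with dec (E h)
  ... | yes eh = 0# , IsConvexSubgroup.has-0 cX
    , subst E (trans (solve 1 (λ h → h ⊜ h :- :0) refl h) (cong (h −_) (sym (⊙-0 p)))) eh
  ... | no neh with A-isA p h
  ...   | Y , isB@(cY , yh , leastY) , cA , A⊆Y , reg , _ with ¬∀⇒∃¬ (hyp h h≢0 xh neh)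
    where
    h≢0 : h ≢ 0#
    h≢0 eq = neh (subst E (sym eq) (IsConvexSubgroup.has-0 cE))
  ...     | w , ew , naw with reg E cE (∃∉⇒⊆ cE cA ew naw) (∃∉⇒⊆ cY cE yh neh) (w , ew , naw) h yh
  ...       | h′ , yh′ , e = h′ , leastY X cX xh h′ yh′ , e

  QuotDivisible-1 : ∀ {X E} → Convex E → QuotDivisible G 1 E X
  QuotDivisible-1 {X} {E} cE h xh = h , xh , subst E (sym (trans (cong (h −_) (1-⊙ h)) (+-inverseʳ h)))
      (IsConvexSubgroup.has-0 cE)

  QuotDivisible-* : ∀ m n {X E} → Convex E → QuotDivisible G m E X → QuotDivisible G n E X →
      QuotDivisible G (m ℕ.* n) E X
  QuotDivisible-* m n {X} {E} cE divm divn h xh with divm h xh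
  ... | h₁ , xh₁ , e₁ with divn h₁ xh₁
  ...   | h₂ , xh₂ , e₂ = h₂ , xh₂ , subst E eq (IsConvexSubgroup.has-+ cE _ _ e₁ (Quotient.has-⊙ E cE m e₂))
    where
    eq : (h − m ⊙ h₁) + m ⊙ (h₁ − n ⊙ h₂) ≡ h − (m ℕ.* n) ⊙ h₂
    eq = trans (cong ((h − m ⊙ h₁) +_) (trans (⊙-− m h₁ (n ⊙ h₂)) (cong (m ⊙ h₁ −_) (sym (*-⊙ m n h₂)))))
      (solve 3 (λ h a b → (h :- a) :+ (a :- b) ⊜ h :- b) refl h (m ⊙ h₁) ((m ℕ.* n) ⊙ h₂))

  QuotDivisible-^ : ∀ m n {X E} → Convex E → QuotDivisible G m E X → QuotDivisible G (m ^ n) E X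
  QuotDivisible-^ m zero cE div = QuotDivisible-1 cE
  QuotDivisible-^ m (suc n) cE div = QuotDivisible-* m (m ^ n) cE div (QuotDivisible-^ m n cE div)

  RJ-convex : ∀ n {Δ} → RJ G n Δ → Convex Δ
  RJ-convex n (g , g≢0 , X , isB , cΔ , _) = cΔ

  A-RJ : ∀ n {g} → g ≢ 0# → RJ G n (A n g)
  A-RJ n {g} g≢0 = g , g≢0 , A-isA n g

  -- Finiteness of RJ_p and congruences modulo D + p^m G

  module _ (bounded : BoundedRegularRank G) where

    -- The subsets enumerated by the hypothesis may lie outside RJ_p, and only members of RJ_p index
    -- symbols of the language. Each is replaced by a member equal to it, or dropped if there is
    -- none.
    rjList : ∀ p → Prime p → Σ (List (Σ Sub (RJ G p))) λ L → ∀ Δ → RJ G p Δ → Any (λ y → _≐_ G Δ (proj₁ y)) L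
    rjList p pp with bounded p pp
    ... | k , f , complete = represent k f , λ Δ r → covered k f Δ r (complete Δ r)
      where
      represent : ∀ k → (Fin k → Sub) → List (Σ Sub (RJ G p))
      represent zero f = []
      represent (suc k) f with em {Σ (Σ Sub (RJ G p)) λ y → _≐_ G (proj₁ y) (f fz)}
      ... | yes (y , _) = y ∷ represent k (λ i → f (fs i))
      ... | no _ = represent k (λ i → f (fs i))
      covered : ∀ k f Δ → RJ G p Δ → ∃[ i ] (_≐_ G Δ (f i)) → Any (λ y → _≐_ G Δ (proj₁ y)) (represent k f)
      covered (suc k) f Δ r (fz , s) with em {Σ (Σ Sub (RJ G p)) λ y → _≐_ G (proj₁ y) (f fz)}
      ... | yes (y , t) = here (⊆-trans (proj₁ s) (proj₂ t) , ⊆-trans (proj₁ t) (proj₂ s))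
      ... | no n = contradiction ((Δ , r) , s) n
      covered (suc k) f Δ r (fs i , s) with em {Σ (Σ Sub (RJ G p)) λ y → _≐_ G (proj₁ y) (f fz)}
      ... | yes _ = there (covered k (λ i → f (fs i)) Δ r (i , s))
      ... | no _ = covered k (λ i → f (fs i)) Δ r (i , s)

    leastAbove : ∀ p D (L : List (Σ Sub (RJ G p))) →
      All (λ y → ¬ (D ⊆′ proj₁ y)) L ⊎
      Σ (Σ Sub (RJ G p)) λ y → D ⊆′ proj₁ y × All (λ z → D ⊆′ proj₁ z → proj₁ y ⊆′ proj₁ z) L
    leastAbove p D [] = inj₁ []
    leastAbove p D (y ∷ L) with leastAbove p D L | dec (D ⊆′ proj₁ y)
    ... | inj₁ none | no n = inj₁ (n ∷ none)
    ... | inj₁ none | yes s = inj₂ (y , s , (λ _ _ d → d) ∷ All.map (λ n t → contradiction t n) none)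
    ... | inj₂ (z , t , least) | no n = inj₂ (z , t , (λ s → contradiction s n) ∷ least)
    ... | inj₂ (z , t , least) | yes s with dec (proj₁ z ⊆′ proj₁ y)
    ...   | yes z⊆y = inj₂ (z , t , (λ _ → z⊆y) ∷ least)
    ...   | no z⊈y = inj₂ (y , s , (λ _ _ d → d) ∷
              All.map (λ h u → ⊆-trans (⊈⇒⊇ (RJ-convex p (proj₂ z)) (RJ-convex p (proj₂ y)) z⊈y) (h u)) least)

    -- D + p^m G equals Δ + p^m G for the least Δ ∈ RJ_p above D, and G if there is none.
    CG-primePower : ∀ D (cD : Convex D) p → Prime p → ∀ m →
      (∀ u → CG D (p ^ m) u) ⊎
      Σ Sub λ Δ → Σ (RJ G p Δ) λ r → ∀ u → CG D (p ^ m) u ⇔ CG Δ (p ^ m) u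
    CG-primePower D cD p pp m with rjList p pp
    ... | L , complete with leastAbove p D L
    ...   | inj₁ none = inj₁ λ u → let (h , _ , d) = div u tt in h , d
      where
      div : QuotDivisible G (p ^ m) D Full
      div = QuotDivisible-^ p m cD (regular-cover p Full-convex cD (λ _ _ → tt) λ h h≢0 _ _ D⊆A →
        let (n , s) = All.lookupAny none (complete (A p h) (A-RJ p h≢0)) in n (⊆-trans D⊆A (proj₁ s)))
    ...   | inj₂ ((Δ , r) , D⊆Δ , least) = inj₂ (Δ , r , λ u →
              (λ (z , d) → z , D⊆Δ _ d)
            , λ (z , d) → let (h , _ , e) = div _ d in
                z + h , subst D (trans (solve 3 (λ u a b → (u :- a) :- b ⊜ u :- (a :+ b)) refl u ((p ^ m) ⊙ z)
                    ((p ^ m) ⊙ h))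
                  (cong (u −_) (sym (⊙-+ (p ^ m) z h)))) e)
      where
      -- If D lay in A_p(h) for some h in Δ, then Δ, being least above D, would lie there too, and
      -- with it h, which A_p(h) omits.
      div : QuotDivisible G (p ^ m) D Δ
      div = QuotDivisible-^ p m cD (regular-cover p (RJ-convex p r) cD D⊆Δ λ h h≢0 Δh _ D⊆A →
        let (n , s) = All.lookupAny least (complete (A p h) (A-RJ p h≢0)) in
        isA⇒∌ p h≢0 (A-isA p h) (proj₂ s h (n (⊆-trans D⊆A (proj₁ s)) h Δh)))

  -- Matching the classes of a subgroup

  record IsSubgroup (H : Sub) : Set where
    field
      has-0   : H 0#
      has-+   : ∀ {x y} → H x → H y → H (x + y)
      has-neg : ∀ {x} → H x → H (- x)

    has-− : ∀ {x y} → H x → H y → H (x − y)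
    has-− hx hy = has-+ hx (has-neg hy)

  module _ {H K : Sub} (sH : IsSubgroup H) (sK : IsSubgroup K) {r : ℕ} (t t′ : Fin r → Carrier)
           (agree : ∀ a b → H (t a − t b) ⇔ H (t′ a − t′ b)) (x y : Carrier) where
    private
      module H = IsSubgroup sH
      module K = IsSubgroup sK

      Near Near′ : Fin r → Set
      Near b = ∃[ k ] (K k × H ((x − t b) − k))
      Near′ b = ∃[ k ] (K k × H ((y − t′ b) − k))

    -- If x avoids all classes t b + H while y + K is covered by the classes t′ b + H, then
    -- translating by the elements of K that relate x to the classes it is near to gives an
    -- injective self-map of these finitely many classes which misses the class of y.
    matchClasses : (∀ b → Near b ⇔ Near′ b) → ∃[ k ] (K k × (∀ b → H (x − t b) ⇔ H ((y + k) − t′ b)))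
    matchClasses near with dec (∃[ b ] H (x − t b))
    -- Since 0 is in K, class b is near x and hence near y through some k; then -k carries y into
    -- it, and `agree` decides all other classes.
    ... | yes (b , h) with proj₁ (near b) (0# , K.has-0 , subst H (solve 1 (λ u → u ⊜ u :- :0) refl (x − t b)) h)
    ...   | k , Kk , h′ = - k , K.has-neg Kk , λ a →
              (λ g → subst H (solve 4 (λ y k tb ta → ((y :- tb) :- k) :+ (tb :- ta) ⊜ (y :- k) :- ta) refl y k
                  (t′ b) (t′ a))
                (H.has-+ h′ (proj₁ (agree b a) (subst H (solve 3 (λ x ta tb → (x :- ta) :-
                    (x :- tb) ⊜ tb :- ta) refl x (t a) (t b)) (H.has-− g h)))))
            , (λ g → subst H (solve 3 (λ x ta tb → (x :- tb) :+ (tb :- ta) ⊜ x :- ta) refl x (t a) (t b))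
                (H.has-+ h (proj₂ (agree b a) (subst H (solve 4 (λ y k tb ta → ((y :- k) :- ta) :-
                    ((y :- tb) :- k) ⊜ tb :- ta) refl y k (t′ b) (t′ a))
                  (H.has-− g h′)))))
    matchClasses near | no none with dec (∃[ k ] (K k × (∀ b → ¬ H ((y + k) − t′ b))))
    ... | yes (k , Kk , avoid) = k , Kk , λ b → (λ h → contradiction (b , h) none) , (λ h → contradiction h (avoid b))
    ... | no ¬avoid = contradiction (Finₚ.pigeonhole (ℕₚ.n<1+n r) (λ i → proj₁ (seq (Fin.toℕ i)))) λ
        (i , j , i<j , eq) →
            collision (Fin.toℕ i) (Fin.toℕ j ℕ.∸ suc (Fin.toℕ i))
              (subst (λ n → H (t (proj₁ (seq (Fin.toℕ i))) − t (proj₁ (seq n))))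
                (trans (sym (ℕₚ.m+[n∸m]≡n i<j)) (sym (ℕₚ.+-suc (Fin.toℕ i) _)))
                (subst (λ b → H (t (proj₁ (seq (Fin.toℕ i))) − t b)) eq
                  (subst H (sym (+-inverseʳ _)) H.has-0)))
      where
      covered : ∀ k → K k → ∃[ b ] H ((y + k) − t′ b)
      covered k Kk = byContradiction λ n → ¬avoid (k , Kk , λ b h → n (b , h))

      -- If b is near x through k, take the class of y - k. It is near y through k, hence near x
      -- through a possibly different element.
      next : Σ (Fin r) Near → Σ (Fin r) Near
      next (b , k , Kk , h) with covered (- k) (K.has-neg Kk)
      ... | b′ , h′ = b′ , proj₂ (near b′) (k , Kk , subst H (solve 3 (λ y k tb → (y :- k) :- tb ⊜
          (y :- tb) :- k) refl y k (t′ b′)) h′)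

      seq : ℕ → Σ (Fin r) Near
      seq zero with covered 0# K.has-0
      ... | b , h = b , proj₂ (near b) (0# , K.has-0 , subst H
          (solve 2 (λ y tb → (y :+ :0) :- tb ⊜ (y :- tb) :- :0) refl y (t′ b)) h)
      seq (suc n) = next (seq n)

      next-class : ∀ s → H ((y − proj₁ (proj₂ s)) − t′ (proj₁ (next s)))
      next-class (b , k , Kk , h) = proj₂ (covered (- k) (K.has-neg Kk))

      first-class : H (y − t′ (proj₁ (seq 0)))
      first-class = subst H (solve 2 (λ y tb → (y :+ :0) :- tb ⊜ y :- tb) refl y _) (proj₂ (covered 0# K.has-0))

      next-injective : ∀ s u → H (t (proj₁ (next s)) − t (proj₁ (next u))) → H (t (proj₁ s) − t (proj₁ u))
      next-injective s@(b , k , _ , h) u@(c , l , _ , g) e = subst H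
        (solve 5 (λ x tb tc k l → ((x :- tc) :- l) :- ((x :- tb) :- k) :+ (l :- k) ⊜ tb :- tc) refl x (t b) (t c) k l)
        (H.has-+ (H.has-− g h) (subst H
          (solve 5 (λ y k l sb sc → ((y :- k) :- sb) :- ((y :- l) :- sc) :+ (sb :- sc) ⊜ l :- k) refl y k l _ _)
          (H.has-+ (H.has-− (next-class s) (next-class u)) (proj₁ (agree _ _) e))))

      -- Injectivity pulls a coincidence back to the first term. Then y and y - k share a class, so
      -- k is in H, and x itself lies in the class of `seq j`.
      collision : ∀ i j → H (t (proj₁ (seq i)) − t (proj₁ (seq (i ℕ.+ suc j)))) → ⊥
      collision zero j e = none (proj₁ (seq j) , subst H
        (solve 3 (λ x tb k → ((x :- tb) :- k) :+ k ⊜ x :- tb) refl x _ _)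
        (H.has-+ (proj₂ (proj₂ (proj₂ (seq j)))) (subst H
          (solve 4 (λ y k sb sc → (y :- sb) :- ((y :- k) :- sc) :+ (sb :- sc) ⊜ k) refl y _ _ _)
          (H.has-+ (H.has-− first-class (next-class (seq j))) (proj₁ (agree _ _) e)))))
      collision (suc i) j e = collision i j (next-injective (seq i) (seq (i ℕ.+ suc j)) e)

  module _ (D : Sub) (cD : Convex D) where
    private module D = Quotient D cD

    CG-isSubgroup : ∀ q → IsSubgroup (CG D q)
    CG-isSubgroup q = record { has-0 = D.∈⇒CG D.has-0 ; has-+ = D.CG-+ ; has-neg = D.CG-neg }

    CG-coprime-⇔ : ∀ {a b u} → Coprime a b → CG D (a ℕ.* b) u ⇔ (CG D a u × CG D b u)
    CG-coprime-⇔ {a} {b} cop = (λ h → D.CG-∣ (m∣m*n b) h , D.CG-∣ (n∣m*n a) h) , λ (g , h) → D.CG-coprime cop g h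

    CG-cong : ∀ {q u w} → D (u − w) → CG D q u ⇔ CG D q w
    CG-cong d = D.CG-mod d , D.CG-mod (D.has-−-swap d)

    CG-translate : ∀ {q u k} → CG D q k → CG D q u ⇔ CG D q (u + k)
    CG-translate {q} {u} {k} h = (λ g → D.CG-+ g h)
      , λ g → subst (CG D q) (solve 2 (λ u k → (u :+ k) :- k ⊜ u) refl u k) (D.CG-+ g (D.CG-neg h))

  -- Refining congruences

  module Pattern {r : ℕ} (t t′ : Fin r → Carrier) (Q : ℕ) where

    -- Both directions of the order are compared, so equality modulo D is compared as well.
    Pat : (D : Sub) (cD : Convex D) → Carrier → Carrier → Set
    Pat D cD x x′ = ∀ b →
      ((x ⊑ t b ⇔ x′ ⊑ t′ b) × (t b ⊑ x ⇔ t′ b ⊑ x′))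
      × (∀ q → q ∣ Q → CG D q (x − t b) ⇔ CG D q (x′ − t′ b))
      where open Quotient D cD

    Pat-mod : ∀ {D cD x x′ y y′} → D (x − y) → D (x′ − y′) → Pat D cD x x′ → Pat D cD y y′
    Pat-mod {D} {cD} {x} {x′} {y} {y′} d d′ pat b =
        ( ((λ h → ⊑-trans (∈⇒⊒ d′) (proj₁ (proj₁ (proj₁ (pat b))) (⊑-trans (∈⇒⊑ d) h)))
          , (λ h → ⊑-trans (∈⇒⊒ d) (proj₂ (proj₁ (proj₁ (pat b))) (⊑-trans (∈⇒⊑ d′) h))))
        , ((λ h → ⊑-trans (proj₁ (proj₂ (proj₁ (pat b))) (⊑-trans h (∈⇒⊒ d))) (∈⇒⊑ d′))
          , (λ h → ⊑-trans (proj₂ (proj₂ (proj₁ (pat b))) (⊑-trans h (∈⇒⊒ d′))) (∈⇒⊑ d))))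
      , λ q q∣Q → ⇔-trans (CG-cong D cD (minus (has-−-swap d)))
          (⇔-trans (proj₂ (pat b) q q∣Q) (CG-cong D cD (minus d′)))
      where
      open Quotient D cD
      minus : ∀ {x y s} → D (x − y) → D ((x − s) − (y − s))
      minus {x} {y} {s} = subst D (solve 3 (λ x y s → x :- y ⊜ (x :- s) :- (y :- s)) refl x y s)

    module Refine
      (D X : Sub) (cD : Convex D) (cX : Convex X) (D⊆X : ∀ u → D u → X u)
      (agree : ∀ a → Pat D cD (t a) (t′ a)) where
      private
        module D = Quotient D cD
        module X = Quotient X cX
      open Quotient D cD

      -- The classes modulo D + p^(a+1) G that q X can reach, for q = p^a R, are determined by
      -- the congruences modulo X + p^(a+1) G and D + p^a G (Bézout for p and R).
      near-⇔ : ∀ {p} a R → Prime p → ¬ (p ∣ R) → ∀ u →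
        (∃[ k ] ((∃[ e ] (X e × k ≡ (p ^ a ℕ.* R) ⊙ e)) × CG D (p ^ suc a) (u − k)))
        ⇔ (CG X (p ^ suc a) u × CG D (p ^ a) u)
      near-⇔ {p} a R pp p∤R u = to , from
        where
        q = p ^ a ℕ.* R
        instance
          _ = ℕₚ.m^n≢0 p a {{prime⇒nonZero pp}}

        q-⊙ : ∀ e → q ⊙ e ≡ p ^ a ⊙ (R ⊙ e)
        q-⊙ e = *-⊙ (p ^ a) R e

        suc-⊙ : ∀ e → p ^ suc a ⊙ e ≡ p ^ a ⊙ (p ⊙ e)
        suc-⊙ e = trans (cong (_⊙ e) (ℕₚ.*-comm p (p ^ a))) (*-⊙ (p ^ a) p e)

        to : _
        to (_ , (e , Xe , refl) , z , d) =
            (z , subst X (solve 3 (λ u b c → ((u :- b) :- c) :+ b ⊜ u :- c) refl u (q ⊙ e) (p ^ suc a ⊙ z))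
                   (X.has-+ _ _ (D⊆X _ d) (X.has-⊙ q Xe)))
          , (R ⊙ e + p ⊙ z , subst D (trans (cong₂ (λ b c → (u − b) − c) (q-⊙ e) (suc-⊙ z))
                (trans (solve 3 (λ u b c → (u :- b) :- c ⊜ u :- (b :+ c)) refl u _ _)
                    (cong (u −_) (sym (⊙-+ (p ^ a) (R ⊙ e) (p ⊙ z)))))) d)

        split : ∀ e → X e → ∃[ f ] ∃[ g ] (X f × p ^ a ⊙ e ≡ q ⊙ f + p ^ suc a ⊙ g)
        split e Xe with coprime-Bézout (subst (λ n → Coprime n R) (ℕₚ.*-identityʳ p) (primePower-coprime pp p∤R 1))
        ... | Bézout.-+ x y eq = y ⊙ e , - (x ⊙ e) , X.has-⊙ y Xe , trans (cong (p ^ a ⊙_) e≡)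
              (trans (⊙-+ (p ^ a) _ _) (cong₂ _+_ (sym (q-⊙ (y ⊙ e))) (sym (suc-⊙ _))))
          where
          e≡ : e ≡ R ⊙ (y ⊙ e) + p ⊙ (- (x ⊙ e))
          e≡ = trans (solve 2 (λ e v → e ⊜ (e :+ v) :- v) refl e ((x ℕ.* p) ⊙ e))
            (trans (cong (λ n → n ⊙ e − (x ℕ.* p) ⊙ e) eq)
            (cong₂ _+_ (trans (cong (_⊙ e) (ℕₚ.*-comm y R)) (*-⊙ R y e))
              (trans (cong -_ (trans (cong (_⊙ e) (ℕₚ.*-comm x p)) (*-⊙ p x e))) (sym (⊙-- p (x ⊙ e))))))
        ... | Bézout.+- x y eq = - (y ⊙ e) , x ⊙ e , X.has-neg _ (X.has-⊙ y Xe) , trans (cong (p ^ a ⊙_) e≡)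
              (trans (⊙-+ (p ^ a) _ _) (cong₂ _+_ (sym (q-⊙ _)) (sym (suc-⊙ _))))
          where
          e≡ : e ≡ R ⊙ (- (y ⊙ e)) + p ⊙ (x ⊙ e)
          e≡ = trans (solve 2 (λ e v → e ⊜ :- v :+ (e :+ v)) refl e ((y ℕ.* R) ⊙ e))
            (trans (cong (λ n → - ((y ℕ.* R) ⊙ e) + n ⊙ e) eq)
            (cong₂ _+_ (trans (cong -_ (trans (cong (_⊙ e) (ℕₚ.*-comm y R)) (*-⊙ R y e))) (sym (⊙-- R (y ⊙ e))))
              (trans (cong (_⊙ e) (ℕₚ.*-comm x p)) (*-⊙ p x e))))

        from : _
        -- Both multiples equal u modulo X, so p^a (z₂ - p z₁) is in X, and by torsion-freeness so
        -- is z₂ - p z₁. `split` exchanges p^a times it for an element of qX up to p^(a+1) G.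
        from ((z₁ , d₁) , (z₂ , d₂)) with split (z₂ − p ⊙ z₁) (X.∈-⊙⁻ (p ^ a) (subst X
          (trans (solve 3 (λ u b c → (u :- b) :- (u :- c) ⊜ c :- b) refl u _ _) (sym pᵃe≡)) (X.has-− d₁ (D⊆X _ d₂))))
          where
          pᵃe≡ : p ^ a ⊙ (z₂ − p ⊙ z₁) ≡ p ^ a ⊙ z₂ − p ^ suc a ⊙ z₁
          pᵃe≡ = trans (⊙-− (p ^ a) z₂ (p ⊙ z₁)) (cong (p ^ a ⊙ z₂ −_) (sym (suc-⊙ z₁)))
        ... | f , g , Xf , eq = q ⊙ f , (f , Xf , refl) , z₁ + g , subst D eq′ d₂
          where
          open ≡-Reasoning
          eq′ : u − p ^ a ⊙ z₂ ≡ (u − q ⊙ f) − p ^ suc a ⊙ (z₁ + g)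
          eq′ = begin
            u − p ^ a ⊙ z₂
              ≡⟨ solve 3 (λ u b c → u :- b ⊜ u :- (b :- c) :- c) refl u _ (p ^ suc a ⊙ z₁) ⟩
            u − (p ^ a ⊙ z₂ − p ^ suc a ⊙ z₁) − p ^ suc a ⊙ z₁
              ≡⟨ cong (λ c → u − c − p ^ suc a ⊙ z₁) (trans (cong (p ^ a ⊙ z₂ −_) (suc-⊙ z₁))
                  (trans (sym (⊙-− (p ^ a) z₂ (p ⊙ z₁))) eq)) ⟩
            u − (q ⊙ f + p ^ suc a ⊙ g) − p ^ suc a ⊙ z₁
              ≡⟨ solve 4 (λ u b c d → u :- (b :+ c) :- d ⊜ (u :- b) :- (d :+ c)) refl u _ _ _ ⟩
            (u − q ⊙ f) − (p ^ suc a ⊙ z₁ + p ^ suc a ⊙ g)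
              ≡⟨ cong ((u − q ⊙ f) −_) (sym (⊙-+ (p ^ suc a) z₁ g)) ⟩
            (u − q ⊙ f) − p ^ suc a ⊙ (z₁ + g) ∎

      module _ (x x′ : Carrier) (coarse : ∀ b q → q ∣ Q → CG X q (x − t b) ⇔ CG X q (x′ − t′ b)) where

        Matched : Carrier → ℕ → Set
        Matched w q = ∀ b {p} → Prime p → ∀ m → p ^ m ∣ q → CG D (p ^ m) (x − t b) ⇔ CG D (p ^ m) ((x′ + w) − t′ b)

        -- The correction comes from qX with q = p^a R, so congruences modulo divisors of q persist.
        -- By `near-⇔` the classes within reach are determined by congruences already matched, which
        -- is the hypothesis of `matchClasses`.
        matchPrime : ∀ {p} a R → Prime p → ¬ (p ∣ R) → p ℕ.* (p ^ a ℕ.* R) ∣ Q →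
          ∀ w → X w → Matched w (p ^ a ℕ.* R) → ∃[ v ] (X v × Matched v (p ℕ.* (p ^ a ℕ.* R)))
        matchPrime {p} a R pp p∤R pq∣Q w Xw old =
          extend′ (matchClasses (CG-isSubgroup D cD (p ^ suc a)) sK t t′
            (λ b c → proj₂ (agree b c) (p ^ suc a) p^sa∣Q) x (x′ + w)
            (λ b → ⇔-trans (near-⇔ a R pp p∤R (x − t b)) (⇔-trans
              (⇔-conj (coarse′ b) (old b pp a (m∣m*n R))) (⇔-sym (near-⇔ a R pp p∤R ((x′ + w) − t′ b))))))
          where
          q = p ^ a ℕ.* R
          K : Carrier → Set
          K k = ∃[ e ] (X e × k ≡ q ⊙ e)
          p^sa∣Q : p ^ suc a ∣ Q
          p^sa∣Q = ∣-trans (subst (p ^ suc a ∣_) (ℕₚ.*-assoc p (p ^ a) R) (m∣m*n R)) pq∣Q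
          sK : IsSubgroup K
          sK = record
            { has-0 = 0# , X.has-0 , sym (⊙-0 q)
            ; has-+ = λ { (e , Xe , eq) (f , Xf , eq′) → e + f , X.has-+ _ _ Xe Xf , trans (cong₂ _+_ eq eq′)
                (sym (⊙-+ q e f)) }
            ; has-neg = λ { (e , Xe , eq) → - e , X.has-neg _ Xe , trans (cong -_ eq) (sym (⊙-- q e)) }
            }
          coarse′ : ∀ b → CG X (p ^ suc a) (x − t b) ⇔ CG X (p ^ suc a) ((x′ + w) − t′ b)
          coarse′ b = ⇔-trans (coarse b _ p^sa∣Q) (CG-cong X cX
            (subst X (solve 3 (λ x w s → :- w ⊜ (x :- s) :- ((x :+ w) :- s)) refl x′ w (t′ b)) (X.has-neg _ Xw)))
          extend′ : ∃[ k ] (K k × (∀ b → CG D (p ^ suc a) (x − t b) ⇔ CG D (p ^ suc a) (((x′ + w) + k) − t′ b))) →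
                    ∃[ v ] (X v × Matched v (p ℕ.* q))
          extend′ (k , (e , Xe , k≡) , new) = w + k , X.has-+ _ _ Xw (subst X (sym k≡) (X.has-⊙ q Xe)) , matched
            where
            matched : Matched (w + k) (p ℕ.* q)
            matched b {r} pr m d with primePower∣p*q {a = a} pp p∤R pr m d
            ... | inj₁ d′ = ⇔-trans (old b pr m d′) (subst (λ s → CG D (r ^ m) ((x′ + w) − t′ b) ⇔ CG D (r ^ m) s)
                    (solve 4 (λ x w s k → ((x :+ w) :- s) :+ k ⊜ (x :+ (w :+ k)) :- s) refl x′ w (t′ b) k)
                    (CG-translate D cD (D.CG-∣ d′ (subst (CG D q) (sym k≡) (D.CG-⊙ q e)))))
            ... | inj₂ (refl , refl) = subst (λ s → CG D (p ^ suc a) (x − t b) ⇔ CG D (p ^ suc a) s)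
                    (cong (_− t′ b) (+-assoc x′ w k)) (new b)

        matchPrimes : ∀ ps → product ps ∣ Q → All Prime ps → ∃[ w ] (X w × Matched w (product ps))
        matchPrimes [] _ _ = 0# , X.has-0 , λ b pp m p^m∣1 →
          subst (λ n → CG D n (x − t b) ⇔ CG D n ((x′ + 0#) − t′ b)) (sym (∣1⇒≡1 p^m∣1)) ((λ _ → D.CG-1 _) , (λ _ →
              D.CG-1 _))
        -- The prime p may recur in `ps`; its exponent a there fixes p^(a+1) as the new power.
        matchPrimes (p ∷ ps) pq∣Q (pp ∷ pps) = step (splitPrimePower pp (product ps) {{productOfPrimes≢0 pps}})
          where
          step : ∃[ a ] ∃[ R ] (product ps ≡ p ^ a ℕ.* R × ¬ (p ∣ R)) → ∃[ w ] (X w × Matched w (p ℕ.* product ps))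
          step (a , R , q≡ , p∤R) = let (w , Xw , old) = matchPrimes ps (∣-trans (n∣m*n p) pq∣Q) pps in
            subst (λ n → ∃[ w ] (X w × Matched w (p ℕ.* n))) (sym q≡)
              (matchPrime a R pp p∤R (subst (λ n → p ℕ.* n ∣ Q) q≡ pq∣Q) w Xw (subst (Matched w) q≡ old))

        -- `Matched` treats prime powers only; the other divisors of Q follow by the Chinese
        -- remainder argument of `CG-coprime-⇔`.
        refineCG : .{{NonZero Q}} → ∃[ w ] (X w × (∀ b q → q ∣ Q → CG D q (x − t b) ⇔ CG D q ((x′ + w) − t′ b)))
        refineCG = conclude (factorise Q)
          where
          conclude : PrimeFactorisation Q → ∃[ w ] (X w × (∀ b q → q ∣ Q → CG D q (x − t b) ⇔ CG D q ((x′ + w) − t′ b)))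
          conclude record { factors = ps ; isFactorisation = Q≡ ; factorsPrime = pps } =
            let (w , Xw , matched) = matchPrimes ps (subst (_∣ Q) Q≡ ∣-refl) pps in
            w , Xw , λ b q q∣Q → primePower-induction
              (λ q → q ∣ Q → CG D q (x − t b) ⇔ CG D q ((x′ + w) − t′ b))
              (λ _ → (λ _ → D.CG-1 _) , (λ _ → D.CG-1 _))
              (λ {p} a R pp p∤R ih d → let cop = primePower-coprime pp p∤R (suc a) in
                ⇔-trans (CG-coprime-⇔ D cD cop) (⇔-trans
                  (⇔-conj (matched b pp (suc a) (subst (p ^ suc a ∣_) Q≡ (∣-trans (m∣m*n R) d)))
                          (ih (∣-trans (n∣m*n (p ^ suc a)) d)))
                  (⇔-sym (CG-coprime-⇔ D cD cop))))
              q {{ℕ.≢-nonZero λ { refl → ℕ.≢-nonZero⁻¹ Q (0∣⇒≡0 q∣Q) }}} q∣Q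

  -- Interpolation in the order of G/D

  maximal : ∀ {_~_ : Carrier → Carrier → Set} → Total _~_ → Transitive _~_ →
      ∀ {r} (f : Fin r → Carrier) (P : Fin r → Set) →
    (∀ b → ¬ P b) ⊎ (∃[ l ] (P l × (∀ b → P b → f b ~ f l)))
  maximal total trans {zero} f P = inj₁ λ ()
  maximal {_~_} total trans {suc r} f P = extendBy (dec (P fz))
      (maximal {_~_} total trans (λ b → f (fs b)) (λ b → P (fs b)))
    where
    reflexive : ∀ x → x ~ x
    reflexive x with total x x
    ... | inj₁ h = h
    ... | inj₂ h = h
    extendBy : Dec (P fz) → (∀ b → ¬ P (fs b)) ⊎ (∃[ l ] (P (fs l) × (∀ b → P (fs b) → f (fs b) ~ f (fs l)))) →
      (∀ b → ¬ P b) ⊎ (∃[ l ] (P l × (∀ b → P b → f b ~ f l)))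
    extendBy (no n) (inj₁ none) = inj₁ λ { fz → n ; (fs b) → none b }
    extendBy (no n) (inj₂ (l , Pl , max)) = inj₂ (fs l , Pl , λ { fz p → contradiction p n ; (fs b) p → max b p })
    extendBy (yes p) (inj₁ none) = inj₂ (fz , p , λ { fz _ → reflexive _ ; (fs b) q → contradiction q (none b) })
    extendBy (yes p) (inj₂ (l , Pl , max)) with total (f fz) (f (fs l))
    ... | inj₁ h = inj₂ (fs l , Pl , λ { fz _ → h ; (fs b) q → max b q })
    ... | inj₂ h = inj₂ (fz , p , λ { fz _ → reflexive _ ; (fs b) q → trans (max b q) h })

  lastBefore : (P : ℕ → Set) → P 0 → ∀ n → ¬ P n → ∃[ j ] (j ℕ.< n × P j × ¬ P (suc j))
  lastBefore P P0 zero n = contradiction P0 n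
  lastBefore P P0 (suc m) n with dec (P m)
  ... | yes p = m , ℕₚ.≤-refl , p , n
  ... | no np with lastBefore P P0 m np
  ...   | j , j<m , Pj , n′ = j , ℕₚ.m<n⇒m<1+n j<m , Pj , n′

  module _ (D : Sub) (cD : Convex D) where
    open Quotient D cD

    positive : ∀ {a} → 0# ⊑ a → ¬ D a → 0# ⊏ a
    positive 0⊑a n h = n (subst D (solve 1 (λ a → a :- :0 ⊜ a) refl _) (⊑-antisym h 0⊑a))

    positive⇒∉ : ∀ {a} → 0# ⊏ a → ¬ D a
    positive⇒∉ {a} h d = h (inj₂ (subst D (solve 1 (λ a → a ⊜ a :- :0) refl a) d))

    -- Take x strictly between 0 and W and, by induction, e with n e below W - x; the smaller of x
    -- and e works for n + 1.
    dense-small : ¬ DiscreteQuot G D → ∀ n W → 0# ⊏ W → ∃[ e ] (0# ⊏ e × n ⊙ e ⊏ W)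
    dense-small nd zero W 0⊏W = W , 0⊏W , 0⊏W
    dense-small nd (suc n) W 0⊏W = smaller between
      where
      between : ∃[ x ] (0# ⊏ x × x ⊏ W)
      between = byContradiction λ k → nd (W , positive⇒∉ 0⊏W , ⊏⇒⊑ 0⊏W ,
        λ x nx 0⊑x → byContradiction λ W⋢x → k (x , positive 0⊑x nx , W⋢x))
      smaller : ∃[ x ] (0# ⊏ x × x ⊏ W) → ∃[ e ] (0# ⊏ e × suc n ⊙ e ⊏ W)
      smaller (x , 0⊏x , x⊏W) with dense-small nd n (W − x) (⊏-shift x⊏W (solve 2 (λ x W → W :- x ⊜ (W :- x) :- :0) refl x W))
      ... | e , 0⊏e , ne⊏ with ⊑-total x e
      ...   | inj₁ x⊑e = x , 0⊏x , ⊏-shift (⊑-⊏-trans (⊑-⊙ n x⊑e) ne⊏)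
          (solve 3 (λ x W v → (W :- x) :- v ⊜ W :- (x :+ v)) refl x W (n ⊙ x))
      ...   | inj₂ e⊑x = e , 0⊏e , ⊑-⊏-trans (⊑-+ e⊑x ⊑-refl) (⊏-shift ne⊏ (solve 3 (λ x W v → (W :- x) :- v ⊜ W :-
          (x :+ v)) refl x W (n ⊙ e)))

    -- At the last multiple of o that does not pass x, the remainder is nonnegative and less than o
    -- in G/D, hence zero there.
    between-multiples : ∀ {o} → IsLeastPos G D o → ∀ {a x} n → a ⊏ x → x ⊏ a + n ⊙ o →
      ∃[ c ] (c ℕ.≤ n × D (x − (a + c ⊙ o)))
    between-multiples {o} (_ , _ , least) {a} {x} n a⊏x x⊏ =
      conclude (lastBefore (λ c → a + c ⊙ o ⊑ x) (⊑-shift (⊏⇒⊑ a⊏x) (solve 2 (λ a x → x :- a ⊜ x :-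
          (a :+ :0)) refl a x)) n x⊏)
      where
      conclude : ∃[ c ] (c ℕ.< n × a + c ⊙ o ⊑ x × ¬ (a + suc c ⊙ o ⊑ x)) → ∃[ c ] (c ℕ.≤ n × D (x − (a + c ⊙ o)))
      conclude (c , c<n , below , above) = c , ℕₚ.<⇒≤ c<n , byContradiction λ nd →
        above (⊑-shift (least _ nd (⊑-shift below (solve 2 (λ s x → x :- s ⊜ (x :- s) :- :0) refl (a + c ⊙ o) x)))
          (solve 4 (λ x a o v → (x :- (a :+ v)) :- o ⊜ x :- (a :+ (o :+ v))) refl x a o (c ⊙ o)))

  -- The hypothesis `cover` is Q-regularity of X/D, and `w₀` shows that X/D is nonzero.
  module Interpolate (D X : Sub) (cD : Convex D) (cX : Convex X) (D⊆X : ∀ u → D u → X u)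
    (Q : ℕ) .{{_ : NonZero Q}} {w₀ : Carrier} (Xw₀ : X w₀) (nDw₀ : ¬ D w₀)
    (cover : ∀ E → Convex E → (∀ u → D u → E u) → (∀ u → E u → X u) → (∃[ w ] (E w × ¬ D w)) → QuotDivisible G Q E X)
    where
    open Quotient D cD
    private module X = Quotient X cX

    -- With no upper bound to respect, size suffices: d dominates a - y and 0, e makes the
    -- inequality strict, and multiplying by Q only enlarges d + e.
    above : ∀ {a y} → X (a − y) → ∃[ v ] (X v × a ⊏ y + Q ⊙ v)
    above {a} {y} Xδ = conclude (∃nonneg∉ cX cD Xw₀ nDw₀) bound
      where
      bound : ∃[ d ] (0# ≤ d × X d × a − y ≤ d)
      bound with ≤-total 0# (a − y)
      ... | inj₁ h = a − y , h , Xδ , ≤-refl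
      ... | inj₂ h = 0# , ≤-refl , X.has-0 , h
      conclude : ∃[ e ] (0# ≤ e × X e × ¬ D e) → ∃[ d ] (0# ≤ d × X d × a − y ≤ d) → _
      conclude (e , 0≤e , Xe , nDe) (d , 0≤d , Xd , δ≤d) = d + e , X.has-+ _ _ Xd Xe ,
        ⊏-⊑-trans
          (⊏-shift (⊑-⊏-+ {a − y} {d} {0#} {e} (inj₁ δ≤d) (positive D cD (inj₁ 0≤e) nDe))
            (solve 4 (λ a y d e → (d :+ e) :- ((a :- y) :+ :0) ⊜ (y :+ (d :+ e)) :- a) refl a y d e))
          (⊑-+ ⊑-refl (⊑-⊙-self Q (⊑-trans (inj₁ 0≤d) (⊑-shift {0#} {e} (inj₁ 0≤e) (solve 2 (λ d e → e :- :0 ⊜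
              (d :+ e) :- d) refl d e)))))

    below : ∀ {b y} → X (b − y) → ∃[ v ] (X v × y + Q ⊙ v ⊏ b)
    below {b} {y} Xδ = conclude (above (subst X (solve 2 (λ b y → :- (b :- y) ⊜ :- b :- :- y) refl b y)
        (X.has-neg _ Xδ)))
      where
      conclude : ∃[ v ] (X v × - b ⊏ - y + Q ⊙ v) → _
      conclude (v , Xv , h) = - v , X.has-neg _ Xv , subst (λ z → y + z ⊏ b) (sym (⊙-- Q v))
        (⊏-shift h (solve 3 (λ b y v → (:- y :+ v) :- :- b ⊜ b :- (y :- v)) refl b y (Q ⊙ v)))

    module _ {e : Carrier} (0⊏e : 0# ⊏ e) (Xe : X e) where
      private
        0⊑e : 0# ⊑ e
        0⊑e = ⊏⇒⊑ 0⊏e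

        -- The convex subgroup generated by D and e.
        E : Sub
        E x = ∃[ k ] (x ⊑ k ⊙ e × - x ⊑ k ⊙ e)

        E-⊑ : ∀ {x k l} → k ℕ.≤ l → x ⊑ k ⊙ e → x ⊑ l ⊙ e
        E-⊑ k≤l h = ⊑-trans h (⊑-⊙-monoˡ k≤l 0⊑e)

        E-convex : Convex E
        E-convex = record
          { has-0 = 0 , ⊑-refl , subst (_⊑ 0#) (sym -0≡0) ⊑-refl
          ; has-+ = λ { x y (k , p , q) (l , p′ , q′) → k ℕ.+ l
              , subst (x + y ⊑_) (sym (+-⊙ k l e)) (⊑-+ p p′)
              , subst₂ _⊑_ (sym (-‿+ x y)) (sym (+-⊙ k l e)) (⊑-+ q q′) }
          ; has-neg = λ { x (k , p , q) → k , q , subst (_⊑ k ⊙ e) (sym (-‿invol x)) p }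
          ; convex = λ { a x b (k , p , q) (l , p′ , q′) a≤x x≤b → k ℕ.+ l
              , ⊑-trans {x} {b} (inj₁ x≤b) (E-⊑ (ℕₚ.m≤n+m l k) p′)
              , ⊑-trans { - x} { - a} (inj₁ (neg-antitone a≤x)) (E-⊑ (ℕₚ.m≤m+n k l) q) }
          }

        D⊆E : ∀ u → D u → E u
        D⊆E u d = 0 , inj₂ (subst D (solve 1 (λ u → u ⊜ u :- :0) refl u) d)
                    , inj₂ (subst D (solve 1 (λ u → :- u ⊜ :- u :- :0) refl u) (has-neg _ d))

        E⊆X : ∀ u → E u → X u
        E⊆X u (k , p , q) = subst X (solve 1 (λ u → u :- :0 ⊜ u) refl u) (X.⊑-antisym (X⊑0 p)
          (X.⊑-shift (X⊑0 q) (solve 1 (λ u → :0 :- :- u ⊜ u :- :0) refl u)))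
          where
          X⊑0 : ∀ {u} → u ⊑ k ⊙ e → QLe G X u 0#
          X⊑0 h = X.⊑-trans (⊆-⊑ D⊆X h) (inj₂ (subst X (solve 1 (λ u → u ⊜ u :- :0) refl (k ⊙ e)) (X.has-⊙ k Xe)))

      -- As X/E is Q-divisible, y differs from a, up to some Q h, by an amount bounded by a multiple
      -- of e. From there one walks in steps of Q e, which lie in QX; the first point beyond a is
      -- still before b because the gap exceeds one step.
      between : ∀ {a b y} → X (y − a) → a + Q ⊙ e ⊏ b → ∃[ v ] (X v × a ⊏ y + Q ⊙ v × y + Q ⊙ v ⊏ b)
      between {a} {b} {y} Xδ gap = conclude (cover E E-convex D⊆E E⊆X (e , (1 , e⊑ , -e⊑) , positive⇒∉ D cD 0⊏e)
          (y − a) Xδ)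
        where
        s = Q ⊙ e
        e⊑ : e ⊑ 1 ⊙ e
        e⊑ = subst (e ⊑_) (sym (1-⊙ e)) ⊑-refl
        -e⊑ : - e ⊑ 1 ⊙ e
        -e⊑ = ⊑-trans (⊑-trans (⊑-neg 0⊑e) (subst (_⊑ e) (sym -0≡0) 0⊑e)) e⊑
        e⊑s : e ⊑ s
        e⊑s = ⊑-⊙-self Q 0⊑e
        0⊏s : 0# ⊏ s
        0⊏s = ⊏-⊑-trans 0⊏e e⊑s
        conclude : ∃[ h ] (X h × E ((y − a) − Q ⊙ h)) → _
        conclude (h , Xh , k , ε⊑ , -ε⊑) = finish (lastBefore (λ j → f j ⊑ 0#) f0⊑ (suc (k ℕ.+ k)) f-large)
          where
          ε = (y − a) − Q ⊙ h
          -- The offset from a after j steps, begun k steps back. As ε lies between -k s and k s, it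
          -- starts at or below 0 and is positive after 2k + 1 steps.
          f : ℕ → Carrier
          f j = (ε − k ⊙ s) + j ⊙ s
          f0⊑ : f 0 ⊑ 0#
          f0⊑ = ⊑-shift (⊑-trans ε⊑ (⊑-⊙ k e⊑s)) (solve 2 (λ ε v → v :- ε ⊜ :0 :- ((ε :- v) :+ :0)) refl ε (k ⊙ s))
          f-large : 0# ⊏ f (suc (k ℕ.+ k))
          f-large = ⊏-shift (⊑-⊏-+ (⊑-trans -ε⊑ (⊑-⊙ k e⊑s)) 0⊏s)
            (trans (solve 3 (λ ε v s → (v :+ s) :- (:- ε :+ :0) ⊜ ((ε :- v) :+ (s :+ (v :+ v))) :- :0) refl ε (k ⊙ s) s)
              (cong (λ u → ((ε − k ⊙ s) + (s + u)) − 0#) (sym (+-⊙ k k s))))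
          finish : ∃[ j ] (j ℕ.< suc (k ℕ.+ k) × f j ⊑ 0# × ¬ (f (suc j) ⊑ 0#)) → _
          finish (j , _ , fj⊑0 , 0⊏fsj) = v , X.has-− (X.has-− (X.has-⊙ (suc j) Xe) (X.has-⊙ k Xe)) Xh
            , ⊏-shift 0⊏fsj (trans (solve 2 (λ F a → F :- :0 ⊜ (a :+ F) :- a) refl (f (suc j)) a) (cong (_− a) z≡))
            , ⊑-⊏-trans (⊑-shift fj⊑0 (trans (solve 5 (λ a ε c s d → :0 :- ((ε :- c) :+ d) ⊜ (a :+ s) :- (a :+
                ((ε :- c) :+ (s :+ d)))) refl a ε (k ⊙ s) s (j ⊙ s))
                (cong ((a + s) −_) z≡))) gap
            where
            v = suc j ⊙ e − k ⊙ e − h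
            z≡ : a + f (suc j) ≡ y + Q ⊙ v
            z≡ = trans (cong₂ (λ c d → a + ((ε − c) + d)) (⊙-comm k Q e) (⊙-comm (suc j) Q e))
              (trans (solve 5 (λ a y h c d → a :+ ((((y :- a) :- h) :- c) :+ d) ⊜ y :+ ((d :- c) :- h)) refl a y
                  (Q ⊙ h) _ _)
                (cong (y +_) (sym (trans (⊙-− Q (suc j ⊙ e − k ⊙ e) h) (cong (_− Q ⊙ h) (⊙-− Q (suc j ⊙ e) (k ⊙ e)))))))

  -- Passing from X to D in one step of the descent

  module LevelStep {r : ℕ} (t t′ : Fin r → Carrier) (Q : ℕ) .{{_ : NonZero Q}}
    (D X : Sub) (cD : Convex D) (cX : Convex X) (D⊆X : ∀ u → D u → X u)
    (o : Carrier) (least : IsLeastPos G D o ⊎ ¬ DiscreteQuot G D)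
    where
    open Pattern t t′ Q
    open Quotient D cD
    private module X = Quotient X cX

    module _ (agree : ∀ a → Pat D cD (t a) (t′ a))
      (multiples : ∀ b c → c ℕ.≤ Q → Pat D cD (t b + c ⊙ o) (t′ b + c ⊙ o))
      (cover : ∀ E → Convex E → (∀ u → D u → E u) → (∀ u → E u → X u) → (∃[ w ] (E w × ¬ D w)) → QuotDivisible G Q E X)
      (x x′ : Carrier) (coarse : Pat X cX x x′)
      (far : ∀ b c → c ℕ.≤ Q → ¬ D (x − (t b + c ⊙ o)))
      where
      open Refine D X cD cX D⊆X agree

      private
        near : ∀ b → X (x − t b) ⇔ X (x′ − t′ b)
        near b = (λ d → X.⊑-antisym (proj₁ (proj₁ (proj₁ (coarse b))) (X.∈⇒⊑ d))
            (proj₁ (proj₂ (proj₁ (coarse b))) (X.∈⇒⊒ d)))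
               , (λ d → X.⊑-antisym (proj₂ (proj₁ (proj₁ (coarse b))) (X.∈⇒⊑ d))
                   (proj₂ (proj₂ (proj₁ (coarse b))) (X.∈⇒⊒ d)))

        x≢t : ∀ b → ¬ D (x − t b)
        x≢t b d = far b 0 ℕ.z≤n (subst D (solve 2 (λ x a → x :- a ⊜ x :- (a :+ :0)) refl x (t b)) d)

        agree-⊑ : ∀ a b → t a ⊑ t b ⇔ t′ a ⊑ t′ b
        agree-⊑ a b = proj₁ (proj₁ (agree a b))

        agree-⊏ : ∀ {a b} → t a ⊏ t b → t′ a ⊏ t′ b
        agree-⊏ {a} {b} h q = h (proj₂ (agree-⊑ b a) q)

      OrderPat : Carrier → Set
      OrderPat z = ∀ b → (x ⊑ t b ⇔ z ⊑ t′ b) × (t b ⊑ x ⇔ t′ b ⊑ z)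

      -- For t b not congruent to x modulo X the side is already decided, since the orders of G/D
      -- and G/X agree on such pairs. For the others `far` with c = 0 excludes equality modulo D, so
      -- strict inequalities suffice.
      placed : ∀ z → X (z − x′) →
        (∀ b → X (x − t b) → t b ⊏ x → t′ b ⊏ z) → (∀ b → X (x − t b) → x ⊏ t b → z ⊏ t′ b) → OrderPat z
      placed z Xzx′ low high b with dec (X (x − t b))
      ... | yes Xxt with ⊑-total x (t b)
      ...   | inj₁ x⊑t = let x⊏t = ⊑∧∉⇒⊏ x⊑t (x≢t b) ; z⊏t′ = high b Xxt x⊏t in
                ((λ _ → ⊏⇒⊑ z⊏t′) , (λ _ → x⊑t)) , ((λ h → contradiction h x⊏t) , (λ h → contradiction h z⊏t′))
      ...   | inj₂ t⊑x = let t⊏x = ⊑∧∉⇒⊏ t⊑x (λ d → x≢t b (has-−-swap d)) ; t′⊏z = low b Xxt t⊏x in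
                ((λ h → contradiction h t⊏x) , (λ h → contradiction h t′⊏z)) , ((λ _ → ⊏⇒⊑ t′⊏z) , (λ _ → t⊑x))
      placed z Xzx′ low high b | no nX =
          ((λ h → X⇒D nXz (X.⊑-trans (X.∈⇒⊑ Xzx′) (proj₁ (proj₁ (proj₁ (coarse b))) (⊆-⊑ D⊆X h))))
          , (λ h → X⇒D nX (proj₂ (proj₁ (proj₁ (coarse b))) (X.⊑-trans (X.∈⇒⊒ Xzx′) (⊆-⊑ D⊆X h)))))
        , ((λ h → X⇒D (λ d → nXz (X.has-−-swap d)) (X.⊑-trans (proj₁ (proj₂ (proj₁ (coarse b))) (⊆-⊑ D⊆X h))
            (X.∈⇒⊒ Xzx′)))
          , (λ h → X⇒D (λ d → nX (X.has-−-swap d)) (proj₂ (proj₂ (proj₁ (coarse b)))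
              (X.⊑-trans (⊆-⊑ D⊆X h) (X.∈⇒⊑ Xzx′)))))
        where
        X⇒D : ∀ {u w} → ¬ X (u − w) → QLe G X u w → u ⊑ w
        X⇒D n (inj₁ h) = inj₁ h
        X⇒D n (inj₂ d) = contradiction d n
        nXz : ¬ X (z − t′ b)
        nXz d = nX (proj₂ (near b) (X.has-−-trans (X.has-−-swap Xzx′) d))

      module _ {w₀ : Carrier} (Xw₀ : X w₀) (nDw₀ : ¬ D w₀) (y : Carrier) (Xyx′ : X (y − x′)) where
        open Interpolate D X cD cX D⊆X Q Xw₀ nDw₀ cover

        Below Above : Fin r → Set
        Below b = X (x − t b) × t b ⊏ x
        Above b = X (x − t b) × x ⊏ t b

        near-y : ∀ {b} → X (x − t b) → X (y − t′ b)
        near-y {b} d = X.has-−-trans Xyx′ (proj₁ (near b) d)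

        near-z : ∀ {v} → X v → X ((y + Q ⊙ v) − x′)
        near-z {v} Xv = subst X (solve 3 (λ y v x → (y :- x) :+ v ⊜ (y :+ v) :- x) refl y (Q ⊙ v) x′)
            (X.has-+ _ _ Xyx′ (X.has-⊙ Q Xv))

        step : ∀ l r → Below l → Above r → ∃[ e ] (0# ⊏ e × X e × t′ l + Q ⊙ e ⊏ t′ r)
        step l r (Xl , l⊏x) (Xr , x⊏r) = choose least
          where
          Xgap : X (t′ r − t′ l)
          Xgap = X.has-−-trans (X.has-−-swap (near-y Xr)) (near-y Xl)
          -- The element e is squeezed into X between 0 and the gap t′ r - t′ l.
          withX : ∀ {e} → 0# ⊏ e → t′ l + Q ⊙ e ⊏ t′ r → ∃[ e ] (0# ⊏ e × X e × t′ l + Q ⊙ e ⊏ t′ r)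
          withX {e} 0⊏e gap = e , 0⊏e , subst X (solve 1 (λ e → e :- :0 ⊜ e) refl e)
            (X.⊑-antisym (X.⊑-trans (⊆-⊑ D⊆X (⊑-trans (⊑-⊙-self Q (⊏⇒⊑ 0⊏e))
                (⊑-shift (⊏⇒⊑ gap) (solve 3 (λ l r s → r :- (l :+ s) ⊜ (r :- l) :- s) refl (t′ l) (t′ r) (Q ⊙ e)))))
              (inj₂ (subst X (solve 1 (λ u → u ⊜ u :- :0) refl (t′ r − t′ l)) Xgap))) (⊆-⊑ D⊆X (⊏⇒⊑ 0⊏e)))
            , gap
          choose : IsLeastPos G D o ⊎ ¬ DiscreteQuot G D → ∃[ e ] (0# ⊏ e × X e × t′ l + Q ⊙ e ⊏ t′ r)
          -- A primed gap of at most Q·o would, by `multiples` with c = Q, be one on the unprimed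
          -- side too, and x would equal some t l + c·o modulo D, against `far`.
          choose (inj₁ lp) = withX (positive D cD (proj₁ (proj₂ lp)) (proj₁ lp)) λ r⊑ →
            let (c , c≤Q , d) = between-multiples D cD lp Q l⊏x
                  (⊏-⊑-trans x⊏r (proj₂ (proj₂ (proj₁ (multiples l Q ℕₚ.≤-refl r))) r⊑))
            in far l c c≤Q d
          choose (inj₂ nd) = let (e , 0⊏e , small) = dense-small D cD nd Q (t′ r − t′ l)
                                   (⊏-shift (agree-⊏ (⊏-⊑-trans l⊏x (⊏⇒⊑ x⊏r)))
                                     (solve 2 (λ l r → r :- l ⊜ (r :- l) :- :0) refl (t′ l) (t′ r)))
            in withX 0⊏e (⊏-shift small (solve 3 (λ l r s → (r :- l) :- s ⊜ r :- (l :+ s)) refl (t′ l) (t′ r) (Q ⊙ e)))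

        LowerBound UpperBound : Set
        LowerBound = (∀ b → ¬ Below b) ⊎ (∃[ l ] (Below l × (∀ b → Below b → t b ⊑ t l)))
        UpperBound = (∀ b → ¬ Above b) ⊎ (∃[ r ] (Above r × (∀ b → Above b → t r ⊑ t b)))

        refineOrder : ∃[ v ] (X v × OrderPat (y + Q ⊙ v))
        refineOrder = choose
          (maximal {_⊑_} ⊑-total ⊑-trans t Below)
          (maximal {λ a b → b ⊑ a} (λ a b → ⊑-total b a) (λ p q → ⊑-trans q p) t Above)
          where
          choose : LowerBound → UpperBound → ∃[ v ] (X v × OrderPat (y + Q ⊙ v))
          choose (inj₁ noBelow) (inj₁ noAbove) = 0# , X.has-0 , placed (y + Q ⊙ 0#) (near-z X.has-0)
            (λ b d h → contradiction (d , h) (noBelow b)) (λ b d h → contradiction (d , h) (noAbove b))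
          choose (inj₂ (l , Bl , max)) (inj₁ noAbove) =
            let (v , Xv , l⊏z) = above {t′ l} {y} (X.has-−-swap (near-y (proj₁ Bl))) in
            v , Xv , placed (y + Q ⊙ v) (near-z Xv)
              (λ b d h → ⊑-⊏-trans (proj₁ (agree-⊑ b l) (max b (d , h))) l⊏z)
                  (λ b d h → contradiction (d , h) (noAbove b))
          choose (inj₁ noBelow) (inj₂ (r , Ar , min)) =
            let (v , Xv , z⊏r) = below {t′ r} {y} (X.has-−-swap (near-y (proj₁ Ar))) in
            v , Xv , placed (y + Q ⊙ v) (near-z Xv)
              (λ b d h → contradiction (d , h) (noBelow b)) (λ b d h → ⊏-⊑-trans z⊏r (proj₁ (agree-⊑ r b) (min b
                  (d , h))))
          choose (inj₂ (l , Bl , max)) (inj₂ (r , Ar , min)) =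
            let (e , 0⊏e , Xe , gap) = step l r Bl Ar
                (v , Xv , l⊏z , z⊏r) = between 0⊏e Xe {t′ l} {t′ r} {y} (near-y (proj₁ Bl)) gap in
            v , Xv , placed (y + Q ⊙ v) (near-z Xv)
              (λ b d h → ⊑-⊏-trans (proj₁ (agree-⊑ b l) (max b (d , h))) l⊏z)
              (λ b d h → ⊏-⊑-trans z⊏r (proj₁ (agree-⊑ r b) (min b (d , h))))

      -- Congruences precede the order because the later move by QX changes none of them, every q
      -- being a divisor of Q. If X = D, the coarse pattern is already the required one.
      refine : ∃[ z ] (X (z − x′) × Pat D cD x z)
      refine with dec (∀ u → X u → D u)
      ... | yes X⊆D = x′ , X.has-−-refl , λ b →
              ( ((λ h → ⊆-⊑ X⊆D (proj₁ (proj₁ (proj₁ (coarse b))) (⊆-⊑ D⊆X h))) ,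
                  (λ h → ⊆-⊑ X⊆D (proj₂ (proj₁ (proj₁ (coarse b))) (⊆-⊑ D⊆X h))))
              , ((λ h → ⊆-⊑ X⊆D (proj₁ (proj₂ (proj₁ (coarse b))) (⊆-⊑ D⊆X h))) ,
                  (λ h → ⊆-⊑ X⊆D (proj₂ (proj₂ (proj₁ (coarse b))) (⊆-⊑ D⊆X h)))))
              , λ q q∣Q → (λ (z , d) → CG-⊆ X⊆D (proj₁ (proj₂ (coarse b) q q∣Q) (z , D⊆X _ d)))
                        , (λ (z , d) → CG-⊆ X⊆D (proj₂ (proj₂ (coarse b) q q∣Q) (z , D⊆X _ d)))
        where
        CG-⊆ : ∀ {q u} → (∀ u → X u → D u) → CG X q u → CG D q u
        CG-⊆ s (z , d) = z , s _ d
      ... | no n = conclude (¬∀⇒∃¬ n) (refineCG x x′ (λ b → proj₂ (coarse b)))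
        where
        conclude : ∃[ w₀ ] (X w₀ × ¬ D w₀) → ∃[ w ] (X w × (∀ b q → q ∣ Q →
            CG D q (x − t b) ⇔ CG D q ((x′ + w) − t′ b))) →
          ∃[ z ] (X (z − x′) × Pat D cD x z)
        conclude (w₀ , Xw₀ , nDw₀) (w , Xw , fine) =
          let Xyx′ = subst X (solve 2 (λ x w → w ⊜ (x :+ w) :- x) refl x′ w) Xw
              (v , Xv , ord) = refineOrder Xw₀ nDw₀ (x′ + w) Xyx′
          in (x′ + w) + Q ⊙ v , near-z Xw₀ nDw₀ (x′ + w) Xyx′ Xv , λ b → ord b , λ q q∣Q →
               ⇔-trans (fine b q q∣Q) (subst (λ s → CG D q ((x′ + w) − t′ b) ⇔ CG D q s)
                 (solve 3 (λ y s v → (y :- s) :+ v ⊜ (y :+ v) :- s) refl (x′ + w) (t′ b) (Q ⊙ v))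
                 (CG-translate D cD (CG-∣ q∣Q (CG-⊙ Q v))))

  -- Descent along the chain of convex subgroups

  -- Without a least positive element in the quotient, `unit` may be any element; the points t b +
  -- c·unit can thus be written uniformly.
  record Stage : Set₁ where
    field
      set       : Sub
      isConvex  : Convex set
      unit      : Carrier
      unitLeast : IsLeastPos G set unit ⊎ ¬ DiscreteQuot G set

  open Stage

  infix 4 _≼_
  _≼_ : Stage → Stage → Set
  E ≼ F = set E ⊆′ set F

  Sorting : List Stage → Set₁
  Sorting L = Σ (List Stage) λ S → AllPairs _≼_ S × (∀ {E} → E ∈ L → E ∈ S) × (∀ {E} → E ∈ S → E ∈ L)

  insertLevel : ∀ E {L} → Sorting L → Sorting (E ∷ L)
  insertLevel E {L} (S , sorted , L⊆S , S⊆L) =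
    let (S′ , sorted′ , to , from) = go S sorted in
    S′ , sorted′ , (λ { (here eq) → to (here eq) ; (there m) → to (there (L⊆S m)) })
       , λ m → unsort (from m)
    where
    go : ∀ S → AllPairs _≼_ S → Sorting (E ∷ S)
    go [] [] = E ∷ [] , [] ∷ [] , (λ m → m) , (λ m → m)
    go (F ∷ S) (F≼ ∷ sorted) with dec (E ≼ F)
    ... | yes E≼F = E ∷ F ∷ S , (E≼F ∷ All.map (λ s → ⊆-trans E≼F s) F≼) ∷ F≼ ∷ sorted , (λ m → m) , (λ m → m)
    ... | no n with go S sorted
    ...   | S′ , sorted′ , to , from = F ∷ S′ , All.tabulate (λ m → F≼′ (from m)) ∷ sorted′
          , (λ { (here eq) → there (to (here eq)) ; (there (here eq)) → here eq ; (there (there m)) → there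
              (to (there m)) })
          , (λ { (here eq) → there (here eq) ; (there m) → swap (from m) })
      where
      F≼′ : ∀ {H} → H ∈ E ∷ S → F ≼ H
      F≼′ (here refl) = ⊈⇒⊇ (isConvex E) (isConvex F) n
      F≼′ (there m) = All.lookup F≼ m
      swap : ∀ {H} → H ∈ E ∷ S → H ∈ E ∷ F ∷ S
      swap (here eq) = here eq
      swap (there m) = there (there m)
    unsort : ∀ {H} → H ∈ E ∷ S → H ∈ E ∷ L
    unsort (here eq) = here eq
    unsort (there m) = there (S⊆L m)

  sortLevels : ∀ L → Sorting L
  sortLevels [] = [] , [] , (λ m → m) , (λ m → m)
  sortLevels (E ∷ L) = insertLevel E (sortLevels L)

  module Descent {r : ℕ} (t t′ : Fin r → Carrier) (Q : ℕ) .{{_ : NonZero Q}} (levels : List Stage)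
    (rj : ∀ p → Prime p → p ∣ Q → ∀ h → h ≢ 0# → Any (λ E → _≐_ G (A p h) (set E)) levels) where
    open Pattern t t′ Q

    LPat : Stage → Carrier → Carrier → Set
    LPat E = Pat (set E) (isConvex E)

    -- `multiples` ranges over pairs of stages because a point built from the unit of F is also used
    -- at the stages E above F.
    module _ (agree : ∀ {E} → E ∈ levels → ∀ a → LPat E (t a) (t′ a))
      (multiples : ∀ {E F} → E ∈ levels → F ∈ levels → ∀ b c → c ℕ.≤ Q →
         LPat E (t b + c ⊙ unit F) (t′ b + c ⊙ unit F))
      (x : Carrier) where

      module Adjacent (D : Stage) (X : Sub) (cX : Convex X) (D⊆X : set D ⊆′ X)
        (adjacent : ∀ {E} → E ∈ levels → E ≼ D ⊎ X ⊆′ set E) where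

        -- If E lay in A_p(h) for some h in X, this A_p(h), being a stage, would lie in D, against
        -- w, or contain X, and so its own h.
        cover : ∀ E → Convex E → set D ⊆′ E → E ⊆′ X → ∃[ w ] (E w × ¬ set D w) → QuotDivisible G Q E X
        cover E cE D⊆E E⊆X (w , Ew , nDw) = conclude (factorise Q)
          where
          prime : ∀ p → Prime p → p ∣ Q → QuotDivisible G p E X
          prime p pp p∣Q = regular-cover p cX cE E⊆X λ h h≢0 Xh _ E⊆A →
            let (F , F∈ , (A⊆F , F⊆A)) = find (rj p pp p∣Q h h≢0) in
            refute h h≢0 Xh E⊆A {F} A⊆F F⊆A (adjacent F∈)
            where
            refute : ∀ h → h ≢ 0# → X h → E ⊆′ A p h → ∀ {F} → A p h ⊆′ set F → set F ⊆′ A p h →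
                     F ≼ D ⊎ X ⊆′ set F → ⊥
            refute h h≢0 Xh E⊆A {F} A⊆F F⊆A (inj₁ F≼D) = nDw (F≼D _ (A⊆F _ (E⊆A _ Ew)))
            refute h h≢0 Xh E⊆A {F} A⊆F F⊆A (inj₂ X⊆F) = isA⇒∌ p h≢0 (A-isA p h) (F⊆A _ (X⊆F _ Xh))
          primes : ∀ ps → All Prime ps → product ps ∣ Q → QuotDivisible G (product ps) E X
          primes [] [] _ = QuotDivisible-1 cE
          primes (p ∷ ps) (pp ∷ pps) d = QuotDivisible-* p (product ps) cE
            (prime p pp (∣-trans (m∣m*n (product ps)) d)) (primes ps pps (∣-trans (n∣m*n p) d))
          conclude : PrimeFactorisation Q → QuotDivisible G Q E X
          conclude record { factors = ps ; isFactorisation = Q≡ ; factorsPrime = pps } =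
            subst (λ n → QuotDivisible G n E X) (sym Q≡) (primes ps pps (subst (_∣ Q) Q≡ ∣-refl))

      -- Above the largest stage stands G itself, where every pattern holds trivially; the descent
      -- may therefore begin with x′ = 0.
      coarser : ∀ {D} S → AllPairs _≼_ S → All (D ≼_) S → ∀ x′ → (∀ {E} → E ∈ S → LPat E x x′) →
        Σ Sub λ X → Σ (Convex X) λ cX → set D ⊆′ X × (∀ {E} → E ∈ S → X ⊆′ set E) × Pat X cX x x′
      coarser [] _ _ x′ _ = Full , Full-convex , (λ _ _ → tt) , (λ ()) , λ b →
        (((λ _ → inj₂ tt) , (λ _ → inj₂ tt)) , ((λ _ → inj₂ tt) , (λ _ → inj₂ tt)))
        , λ q _ → (λ _ → 0# , tt) , (λ _ → 0# , tt)
      coarser (E ∷ S) (E≼ ∷ _) (D≼E ∷ _) x′ pats = set E , isConvex E , D≼E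
        , (λ { (here refl) → λ _ d → d ; (there m) → All.lookup E≼ m }) , pats (here refl)

      -- The recursion builds x′ from the largest stage downwards. The last hypothesis places every
      -- stage outside S below all of S, so none is strictly between D and the subgroup before it.
      descend : ∀ S → AllPairs _≼_ S → (∀ {E} → E ∈ S → E ∈ levels) →
        (∀ {E} → E ∈ levels → E ∈ S ⊎ All (E ≼_) S) →
        ∃[ x′ ] (∀ {E} → E ∈ S → LPat E x x′)
      descend [] _ _ _ = 0# , λ ()
      descend (D ∷ S) (D≼ ∷ sorted) S⊆ split =
        let (x′ , pats) = descend S sorted (λ m → S⊆ (there m)) split′
            (X , cX , D⊆X , X⊆ , patX) = coarser {D} S sorted D≼ x′ pats
        in refineTo X cX D⊆X X⊆ x′ patX pats
        where
        D∈ : D ∈ levels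
        D∈ = S⊆ (here refl)
        split′ : ∀ {E} → E ∈ levels → E ∈ S ⊎ All (E ≼_) S
        split′ m with split m
        ... | inj₁ (here refl) = inj₂ D≼
        ... | inj₁ (there m′) = inj₁ m′
        ... | inj₂ (_ ∷ E≼) = inj₂ E≼
        split-D : ∀ {E} → E ∈ levels → E ≼ D ⊎ E ∈ S
        split-D m with split m
        ... | inj₁ (here refl) = inj₁ (λ _ d → d)
        ... | inj₁ (there m′) = inj₂ m′
        ... | inj₂ (E≼D ∷ _) = inj₁ E≼D

        refineTo : ∀ X (cX : Convex X) → set D ⊆′ X → (∀ {E} → E ∈ S → X ⊆′ set E) →
          ∀ x′ → Pat X cX x x′ → (∀ {E} → E ∈ S → LPat E x x′) → ∃[ z ] (∀ {E} → E ∈ D ∷ S → LPat E x z)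
        refineTo X cX D⊆X X⊆ x′ patX pats with dec (∃[ b ] ∃[ c ] (c ℕ.≤ Q × set D (x − (t b + c ⊙ unit D))))
        -- The x′ found so far is discarded. Since D lies in every stage of D ∷ S, x agrees with t b
        -- + c·unit modulo all of them.
        ... | yes (b , c , c≤Q , d) = t′ b + c ⊙ unit D , λ {E} m → Pat-mod {cD = isConvex E}
                (Quotient.has-−-swap (set E) (isConvex E) (D⊆E m _ d)) (Quotient.has-−-refl (set E) (isConvex E))
                (multiples (S⊆ m) D∈ b c c≤Q)
          where
          D⊆E : ∀ {E} → E ∈ D ∷ S → D ≼ E
          D⊆E (here refl) = λ _ d → d
          D⊆E (there m) = All.lookup D≼ m
        ... | no far = conclude (LevelStep.refine t t′ Q (set D) X (isConvex D) cX D⊆X (unit D) (unitLeast D)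
                (agree D∈) (multiples D∈ D∈) (Adjacent.cover D X cX D⊆X adjacent)
                x x′ patX (λ b c c≤Q d → far (b , c , c≤Q , d)))
          where
          adjacent : ∀ {E} → E ∈ levels → E ≼ D ⊎ X ⊆′ set E
          adjacent m with split-D m
          ... | inj₁ E≼D = inj₁ E≼D
          ... | inj₂ m′ = inj₂ (X⊆ m′)
          conclude : ∃[ z ] (X (z − x′) × Pat (set D) (isConvex D) x z) → ∃[ z ] (∀ {E} → E ∈ D ∷ S → LPat E x z)
          -- X lies in every stage of S, so replacing x′ by z preserves the patterns there.
          conclude (z , Xz , patD) = z , λ
            { (here refl) → patD
            ; {E} (there m) → Pat-mod {cD = isConvex E} (Quotient.has-−-refl (set E) (isConvex E))
                (Quotient.has-−-swap (set E) (isConvex E) (X⊆ m _ Xz)) (pats m) }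

      transfer : ∃[ x′ ] (∀ {E} → E ∈ levels → LPat E x x′)
      transfer = let (S , sorted , to , from) = sortLevels levels
                     (x′ , pats) = descend S sorted from (λ m → inj₁ (to m))
                 in x′ , λ m → pats (to m)

  -- Quantifier-free definability

  module Elimination (bounded : BoundedRegularRank G) (oneI : ConstIx G → Carrier)
    (leastOne : ∀ c → IsLeastPos G (proj₁ c) (oneI c)) where
    open Semantics G oneI

    Env : ℕ → Set
    Env n = Fin n → Carrier

    Definable : ∀ {n} → (Env n → Set) → Set₁
    Definable {n} P = Σ (Formula G n) λ ψ → QF G ψ × (∀ v → Sat ψ v ⇔ P v)

    module _ {n : ℕ} where
      def-⇔ : {P R : Env n → Set} → (∀ v → P v ⇔ R v) → Definable P → Definable R
      def-⇔ eq (ψ , qf , iff) = ψ , qf , λ v → ⇔-trans (iff v) (eq v)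

      def-∧ : {P R : Env n → Set} → Definable P → Definable R → Definable (λ v → P v × R v)
      def-∧ (ψ , qf , iff) (χ , qf′ , iff′) = ψ ∧ᶠ χ , qf-∧ qf qf′ , λ v → ⇔-conj (iff v) (iff′ v)

      def-∨ : {P R : Env n → Set} → Definable P → Definable R → Definable (λ v → P v ⊎ R v)
      def-∨ (ψ , qf , iff) (χ , qf′ , iff′) = ψ ∨ᶠ χ , qf-∨ qf qf′ , λ v →
          (λ { (inj₁ p) → inj₁ (proj₁ (iff v) p) ; (inj₂ r) → inj₂ (proj₁ (iff′ v) r) })
        , (λ { (inj₁ p) → inj₁ (proj₂ (iff v) p) ; (inj₂ r) → inj₂ (proj₂ (iff′ v) r) })

      def-⇒ : {P R : Env n → Set} → Definable P → Definable R → Definable (λ v → P v → R v)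
      def-⇒ (ψ , qf , iff) (χ , qf′ , iff′) = ψ ⇒ᶠ χ , qf-⇒ qf qf′ , λ v →
          (λ f p → proj₁ (iff′ v) (f (proj₂ (iff v) p))) , (λ f p → proj₂ (iff′ v) (f (proj₁ (iff v) p)))

      def-⊥ : Definable {n} (λ _ → ⊥)
      def-⊥ = ⊥ᶠ , qf-⊥ , λ _ → ⇔-refl

      def-¬ : {P : Env n → Set} → Definable P → Definable (λ v → ¬ P v)
      def-¬ d = def-⇒ d def-⊥

      def-true : {P : Env n → Set} → (∀ v → P v) → Definable P
      def-true h = def-⇔ (λ v → (λ _ → h v) , (λ _ b → b)) (def-⇒ def-⊥ def-⊥)

      def-atom : (ψ : Formula G n) → QF G ψ → Definable (Sat ψ)
      def-atom ψ qf = ψ , qf , λ _ → ⇔-refl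

      QFormula : Set₁
      QFormula = Σ (Formula G n) (QF G)

      Agree : List QFormula → Env n → Env n → Set₁
      Agree L v v′ = All (λ ψ → Sat (proj₁ ψ) v ⇔ Sat (proj₁ ψ) v′) L

      -- Requirements on a pair of environments are combined by concatenating lists, so no formula
      -- expressing the conclusion has to be written down.
      Controlled : ∀ {ℓ} → (Env n → Env n → Set ℓ) → Set (lsuc 0ℓ Level.⊔ ℓ)
      Controlled R = Σ (List QFormula) λ L → ∀ v v′ → Agree L v v′ → R v v′

      ctl-def : {P : Env n → Set} → Definable P → Controlled (λ v v′ → P v ⇔ P v′)
      ctl-def (ψ , qf , iff) = (ψ , qf) ∷ [] , λ { v v′ (h ∷ []) → ⇔-trans (⇔-sym (iff v)) (⇔-trans h (iff v′)) }

      ctl-map : ∀ {ℓ ℓ′} {R : Env n → Env n → Set ℓ} {S : Env n → Env n → Set ℓ′} →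
        (∀ v v′ → R v v′ → S v v′) → Controlled R → Controlled S
      ctl-map f (L , h) = L , λ v v′ a → f v v′ (h v v′ a)

      ctl-true : ∀ {ℓ} {R : Env n → Env n → Set ℓ} → (∀ v v′ → R v v′) → Controlled R
      ctl-true h = [] , λ v v′ _ → h v v′

      ctl-× : ∀ {ℓ ℓ′} {R : Env n → Env n → Set ℓ} {S : Env n → Env n → Set ℓ′} →
        Controlled R → Controlled S → Controlled (λ v v′ → R v v′ × S v v′)
      ctl-× (L , h) (M , k) = L ++ M , λ v v′ a → h v v′ (Allₚ.++⁻ˡ L a) , k v v′ (Allₚ.++⁻ʳ L a)

      ctl-Fin : ∀ {ℓ} k {R : Fin k → Env n → Env n → Set ℓ} →
        (∀ i → Controlled (R i)) → Controlled (λ v v′ → ∀ i → R i v v′)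
      ctl-Fin zero h = ctl-true λ _ _ ()
      ctl-Fin (suc k) h = ctl-map (λ v v′ (a , b) → λ { fz → a ; (fs i) → b i })
          (ctl-× (h fz) (ctl-Fin k (λ i → h (fs i))))

      ctl-≤ : ∀ {ℓ} Q {R : ℕ → Env n → Env n → Set ℓ} →
        (∀ c → Controlled (R c)) → Controlled (λ v v′ → ∀ c → c ℕ.≤ Q → R c v v′)
      ctl-≤ Q {R} h = ctl-map
        (λ v v′ f c c≤Q → subst (λ c → R c v v′) (Finₚ.toℕ-fromℕ< (ℕ.s≤s c≤Q)) (f (Fin.fromℕ< (ℕ.s≤s c≤Q))))
        (ctl-Fin (suc Q) (λ i → h (Fin.toℕ i)))

      ctl-∈ : ∀ {a ℓ} {A : Set a} (L : List A) {R : A → Env n → Env n → Set ℓ} →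
        (∀ x → Controlled (R x)) → Controlled (λ v v′ → ∀ {x} → x ∈ L → R x v v′)
      ctl-∈ [] h = ctl-true λ _ _ ()
      ctl-∈ (x ∷ L) h = ctl-map (λ v v′ (a , b) → λ { (here refl) → a ; (there m) → b m }) (ctl-× (h x) (ctl-∈ L h))

      -- Split on the first formula ψ; Local closes each of the two halves of P under agreement
      -- on the remaining formulas.
      controlled⇒definable : {P : Env n → Set} → Controlled (λ v v′ → P v → P v′) → Definable P
      controlled⇒definable (L , h) = go L h
        where
        go : ∀ L {P : Env n → Set} → (∀ v v′ → Agree L v v′ → P v → P v′) → Definable P
        go [] {P} h with dec (∃[ v ] P v)
        ... | yes (v , Pv) = def-true λ v′ → h v v′ [] Pv
        ... | no none = def-⇔ (λ v → ⊥-elim , λ Pv → none (v , Pv)) def-⊥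
        go ((ψ , qf) ∷ L) {P} h = def-⇔ (λ v → to v , from v)
            (def-∨ (def-∧ (def-atom ψ qf) (go L (local (λ v → Sat ψ v))))
                   (def-∧ (def-¬ (def-atom ψ qf)) (go L (local (λ v → ¬ Sat ψ v)))))
          where
          Local : (Env n → Set) → Env n → Set
          Local S v = Resize (Σ (Env n) λ v₀ → S v₀ × P v₀ × Agree L v₀ v)
          local : ∀ S v v′ → Agree L v v′ → Local S v → Local S v′
          local S v v′ a loc = let (v₀ , s , p , a₀) = unresize loc in
            resize (v₀ , s , p , All.zipWith (λ (f , g) → ⇔-trans f g) (a₀ , a))
          to : ∀ v → (Sat ψ v × Local (λ v → Sat ψ v) v) ⊎ (¬ Sat ψ v × Local (λ v → ¬ Sat ψ v) v) → P v
          to v (inj₁ (s , loc)) = let (v₀ , s₀ , p , a) = unresize loc in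
            h v₀ v (((λ _ → s) , (λ _ → s₀)) ∷ a) p
          to v (inj₂ (s , loc)) = let (v₀ , s₀ , p , a) = unresize loc in
            h v₀ v (((λ x → contradiction x s₀) , (λ x → contradiction x s)) ∷ a) p
          from : ∀ v → P v → (Sat ψ v × Local (λ v → Sat ψ v) v) ⊎ (¬ Sat ψ v × Local (λ v → ¬ Sat ψ v) v)
          from v p with dec (Sat ψ v)
          ... | yes s = inj₁ (s , resize (v , s , p , All.universal (λ _ → ⇔-refl) L))
          ... | no s = inj₂ (s , resize (v , s , p , All.universal (λ _ → ⇔-refl) L))

    -- Stages and congruences definable in the language

    infixr 7 _⊙ᵗ_
    _⊙ᵗ_ : ∀ {n} → ℕ → Term G n → Term G n
    zero ⊙ᵗ u = zer
    suc c ⊙ᵗ u = plus u (c ⊙ᵗ u)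

    eval-⊙ᵗ : ∀ {n} c (u : Term G n) v → eval (c ⊙ᵗ u) v ≡ c ⊙ eval u v
    eval-⊙ᵗ zero u v = refl
    eval-⊙ᵗ (suc c) u v = cong (eval u v +_) (eval-⊙ᵗ c u v)

    −0 : ∀ a → a − 0# ≡ a
    −0 = solve 1 (λ a → a :- :0 ⊜ a) refl

    record DefStage : Set₁ where
      field
        stage    : Stage
        member   : ∀ {n} (u : Term G n) → Definable (λ v → set stage (eval u v))
        unitTerm : ∀ {n} → Term G n
        unitEval : ∀ {n} (v : Env n) → eval unitTerm v ≡ unit stage

    open DefStage

    record ClosedUnit (D : Sub) : Set₁ where
      field
        value      : Carrier
        isLeast    : IsLeastPos G D value ⊎ ¬ DiscreteQuot G D
        term       : ∀ {n} → Term G n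
        evaluation : ∀ {n} (v : Env n) → eval term v ≡ value

    -- By `discrete⇒RJ₂` a discrete quotient alone supplies the constant, also for D = {0}; in the
    -- other case 0 is the default.
    closedUnit : ∀ D → Convex D → ClosedUnit D
    closedUnit D cD with dec (DiscreteQuot G D)
    ... | yes disc@(e , lp) = record
      { value = oneI c ; isLeast = inj₁ (leastOne c) ; term = one c ; evaluation = λ _ → refl }
      where
      c : ConstIx G
      c = D , (2 , ℕₚ.≤-refl , discrete⇒RJ₂ D cD e lp) , disc
    ... | no nd = record { value = 0# ; isLeast = inj₂ nd ; term = zer ; evaluation = λ _ → refl }

    defStage : ∀ D → Convex D → (∀ {n} (u : Term G n) → Definable (λ v → D (eval u v))) → DefStage
    defStage D cD mem = record
      { stage = record { set = D ; isConvex = cD ; unit = value ; unitLeast = isLeast }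
      ; member = mem ; unitTerm = term ; unitEval = evaluation }
      where open ClosedUnit (closedUnit D cD)

    zeroStage : DefStage
    zeroStage = defStage Zero Zero-convex λ u → def-atom (u ≈ᶠ zer) (qf-≈ u zer)

    rjStage : ModIx G → DefStage
    rjStage i@(Δ , n , _ , r) = defStage Δ (RJ-convex n r) λ u →
      def-⇔ (λ v → subst Δ (−0 _) , subst Δ (sym (−0 _))) (def-atom (modΔ i u zer) (qf-mΔ i u zer))

    def-⊑ : ∀ {n} (E : DefStage) (u w : Term G n) → Definable (λ v → QLe G (set (stage E)) (eval u v) (eval w v))
    def-⊑ E u w = def-∨ (def-atom (u ≤ᶠ w) (qf-≤ u w)) (member E (plus u (neg w)))

    modP-⇔ : ∀ {Δ} m a → (∃[ d ] ∃[ z ] (Δ d × a ≡ d + m ⊙ z)) ⇔ CG Δ m a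
    modP-⇔ {Δ} m a =
        (λ { (d , z , Δd , eq) → z , subst Δ (trans (solve 2 (λ d b → d ⊜ (d :+ b) :- b) refl d (m ⊙ z))
            (cong (_− m ⊙ z) (sym eq))) Δd })
      , (λ { (z , Δd) → a − m ⊙ z , z , Δd , solve 2 (λ a b → a ⊜ (a :- b) :+ b) refl a (m ⊙ z) })

    -- The modulus is split into prime powers, and for each of them D is traded for a member of
    -- RJ_p, where an atom is available.
    def-CG : ∀ {n} D → Convex D → ∀ q → .{{NonZero q}} → (u : Term G n) → Definable (λ v → CG D q (eval u v))
    def-CG {n} D cD q u = primePower-induction (λ q → Definable (λ v → CG D q (eval u v)))
      (def-true λ v → Quotient.CG-1 D cD (eval u v))
      (λ {p} a R pp p∤R ih → def-⇔ (λ v → ⇔-sym (CG-coprime-⇔ D cD (primePower-coprime pp p∤R (suc a))))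
        (def-∧ (primePower p pp a) ih))
      q
      where
      primePower : ∀ p → Prime p → ∀ a → Definable (λ v → CG D (p ^ suc a) (eval u v))
      primePower p pp a with CG-primePower bounded D cD p pp (suc a)
      ... | inj₁ all = def-true λ v → all (eval u v)
      ... | inj₂ (Δ , r , iff) = def-⇔
              (λ v → ⇔-trans (modP-⇔ (p ^ suc a) (eval u v − 0#))
                (⇔-trans (subst (CG Δ (p ^ suc a)) (−0 _) , subst (CG Δ (p ^ suc a)) (sym (−0 _)))
                    (⇔-sym (iff (eval u v)))))
              (def-atom (modP i u zer) (qf-mP i u zer))
        where
        i : ModPIx G
        i = p , pp , suc a , ℕ.s≤s ℕ.z≤n , Δ , r

    stagesAt : ℕ → List DefStage
    stagesAt p with prime? p
    ... | yes pp = map (λ { (Δ , r) → rjStage (Δ , p , ℕ.nonTrivial⇒n>1 p {{prime⇒nonTrivial pp}} , r) })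
        (proj₁ (rjList bounded p pp))
    ... | no _ = []

    stagesBelow : ℕ → List DefStage
    stagesBelow zero = []
    stagesBelow (suc n) = stagesAt n ++ stagesBelow n

    Represents : Sub → DefStage → Set
    Represents D E = _≐_ G D (set (stage E))

    stagesAt-complete : ∀ p → Prime p → ∀ {Δ} → RJ G p Δ → Any (Represents Δ) (stagesAt p)
    stagesAt-complete p pp {Δ} r with prime? p
    ... | yes pp′ = Anyₚ.map⁺ (proj₂ (rjList bounded p pp′) Δ r)
    ... | no n = contradiction pp n

    stagesBelow-complete : ∀ {n p} → p ℕ.< n → Prime p → ∀ {Δ} → RJ G p Δ → Any (Represents Δ) (stagesBelow n)
    stagesBelow-complete {suc n} {p} (ℕ.s≤s p≤n) pp r with ℕₚ.m≤n⇒m<n∨m≡n p≤n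
    ... | inj₁ p<n = Anyₚ.++⁺ʳ (stagesAt n) (stagesBelow-complete p<n pp r)
    ... | inj₂ refl = Anyₚ.++⁺ˡ (stagesAt-complete p pp r)

    -- Conditions linear in one variable

    -- Equality modulo D is the conjunction of the two inequalities and so needs no kind of its own.
    data Kind : Set where
      ≤0 0≤ : Kind
      modulo : (q : ℕ) → .{{NonZero q}} → Kind

    holds : Kind → Sub → Carrier → Set
    holds ≤0 D a = QLe G D a 0#
    holds 0≤ D a = QLe G D 0# a
    holds (modulo q) D a = CG D q a

    opposite : Kind → Kind
    opposite ≤0 = 0≤
    opposite 0≤ = ≤0
    opposite (modulo q) = modulo q

    holds-neg : ∀ κ {D} → Convex D → ∀ a → holds κ D a ⇔ holds (opposite κ) D (- a)
    holds-neg ≤0 {D} cD a = (λ h → ⊑-shift h (solve 1 (λ a → :0 :- a ⊜ :- a :- :0) refl a))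
                          , (λ h → ⊑-shift h (solve 1 (λ a → :- a :- :0 ⊜ :0 :- a) refl a))
      where open Quotient D cD
    holds-neg 0≤ {D} cD a = (λ h → ⊑-shift h (solve 1 (λ a → a :- :0 ⊜ :0 :- :- a) refl a))
                          , (λ h → ⊑-shift h (solve 1 (λ a → :0 :- :- a ⊜ a :- :0) refl a))
      where open Quotient D cD
    holds-neg (modulo q) {D} cD a = CG-neg , λ h → subst (CG D q) (-‿invol a) (CG-neg h)
      where open Quotient D cD

    record Condition (n : ℕ) : Set₁ where
      constructor condition
      field
        kind        : Kind
        on          : DefStage
        coefficient : ℕ
        rest        : Term G n

    open Condition

    ⟦_⟧ : ∀ {n} → Condition n → Carrier → Env n → Set
    ⟦ α ⟧ x v = holds (kind α) (set (stage (on α))) (coefficient α ⊙ x + eval (rest α) v)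

    Determined : ∀ {n} → (Carrier → Env n → Set) → Set₁
    Determined {n} P = Σ (List (Condition n)) λ L → ∀ x v x′ v′ →
      (∀ {α} → α ∈ L → ⟦ α ⟧ x v ⇔ ⟦ α ⟧ x′ v′) → P x v ⇔ P x′ v′

    linear : ∀ {n} (u : Term G (suc n)) → ∃[ a ] ∃[ b ] Σ (Term G n) λ s →
      ∀ x v → eval u (extend G x v) ≡ (a ⊙ x − b ⊙ x) + eval s v
    linear (var fz) = 1 , 0 , zer , λ x v → solve 1 (λ x → x ⊜ ((x :+ :0) :- :0) :+ :0) refl x
    linear (var (fs i)) = 0 , 0 , var i , λ x v → solve 1 (λ y → y ⊜ (:0 :- :0) :+ y) refl (v i)
    linear zer = 0 , 0 , zer , λ x v → solve 1 (λ y → :0 ⊜ (:0 :- :0) :+ :0) refl x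
    linear (one c) = 0 , 0 , one c , λ x v → solve 1 (λ y → y ⊜ (:0 :- :0) :+ y) refl (oneI c)
    linear (neg u) with linear u
    ... | a , b , s , eq = b , a , neg s , λ x v → trans (cong -_ (eq x v))
            (solve 3 (λ p q s → :- ((p :- q) :+ s) ⊜ (q :- p) :+ :- s) refl (a ⊙ x) (b ⊙ x) (eval s v))
    linear (plus u w) with linear u | linear w
    ... | a , b , s , eq | a′ , b′ , s′ , eq′ = a ℕ.+ a′ , b ℕ.+ b′ , plus s s′ , λ x v →
            trans (cong₂ _+_ (eq x v) (eq′ x v))
            (trans (solve 6 (λ p q s p′ q′ s′ → ((p :- q) :+ s) :+ ((p′ :- q′) :+ s′) ⊜ ((p :+ p′) :- (q :+ q′)) :+
                (s :+ s′)) refl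
              (a ⊙ x) (b ⊙ x) (eval s v) (a′ ⊙ x) (b′ ⊙ x) (eval s′ v))
            (cong₂ (λ p q → (p − q) + (eval s v + eval s′ v)) (sym (+-⊙ a a′ x)) (sym (+-⊙ b b′ x))))

    -- The coefficient of x is a difference of naturals; a sign change makes it natural, at the
    -- price of `opposite` in the condition.
    normal : ∀ {n} (u : Term G (suc n)) → ∃[ m ] Σ (Term G n) λ s →
      (∀ x v → eval u (extend G x v) ≡ m ⊙ x + eval s v) ⊎ (∀ x v → - eval u (extend G x v) ≡ m ⊙ x + eval s v)
    normal u with linear u
    ... | a , b , s , eq with ℕₚ.≤-total a b
    ...   | inj₁ a≤b = b ℕ.∸ a , neg s , inj₂ λ x v → trans (cong -_ (eq x v))
              (trans (cong (λ k → - ((a ⊙ x − k ⊙ x) + eval s v)) (sym (ℕₚ.m+[n∸m]≡n a≤b)))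
              (trans (cong (λ w → - ((a ⊙ x − w) + eval s v)) (+-⊙ a (b ℕ.∸ a) x))
              (solve 3 (λ p q s → :- ((p :- (p :+ q)) :+ s) ⊜ q :+ :- s) refl (a ⊙ x) ((b ℕ.∸ a) ⊙ x) (eval s v))))
    ...   | inj₂ b≤a = a ℕ.∸ b , s , inj₁ λ x v → trans (eq x v)
              (trans (cong (λ k → (k ⊙ x − b ⊙ x) + eval s v) (sym (ℕₚ.m+[n∸m]≡n b≤a)))
              (trans (cong (λ w → (w − b ⊙ x) + eval s v) (+-⊙ b (a ℕ.∸ b) x))
              (solve 3 (λ p q s → ((p :+ q) :- p) :+ s ⊜ q :+ s) refl (b ⊙ x) ((a ℕ.∸ b) ⊙ x) (eval s v))))

    det-⇔ : ∀ {n} {P R : Carrier → Env n → Set} → (∀ x v → P x v ⇔ R x v) → Determined P → Determined R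
    det-⇔ eq (L , h) = L , λ x v x′ v′ a → ⇔-trans (⇔-sym (eq x v)) (⇔-trans (h x v x′ v′ a) (eq x′ v′))

    det-holds : ∀ {n} κ E (u : Term G (suc n)) → Determined (λ x v → holds κ (set (stage E)) (eval u (extend G x v)))
    det-holds κ E u with normal u
    ... | m , s , inj₁ eq = condition κ E m s ∷ [] , λ x v x′ v′ a →
            subst₂ (λ w w′ → holds κ (set (stage E)) w ⇔ holds κ (set (stage E)) w′) (sym (eq x v))
                (sym (eq x′ v′)) (a (here refl))
    ... | m , s , inj₂ eq = condition (opposite κ) E m s ∷ [] , λ x v x′ v′ a →
            ⇔-trans (holds-neg κ (isConvex (stage E)) _) (⇔-trans
              (subst₂ (λ w w′ → holds (opposite κ) (set (stage E)) w ⇔ holds (opposite κ) (set (stage E)) w′)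
                  (sym (eq x v)) (sym (eq x′ v′)) (a (here refl)))
              (⇔-sym (holds-neg κ (isConvex (stage E)) _)))

    det-join : ∀ {n} {P R S : Carrier → Env n → Set} →
      (∀ {x v x′ v′} → P x v ⇔ P x′ v′ → R x v ⇔ R x′ v′ → S x v ⇔ S x′ v′) →
      Determined P → Determined R → Determined S
    det-join f (L , h) (M , k) = L ++ M , λ x v x′ v′ a →
      f (h x v x′ v′ (λ m → a (∈-++⁺ˡ m))) (k x v x′ v′ (λ m → a (∈-++⁺ʳ L m)))

    det-∈ : ∀ {n} E (u : Term G (suc n)) → Determined (λ x v → set (stage E) (eval u (extend G x v)))
    det-∈ E u = det-⇔
      (λ x v → (λ (p , q) → subst (set (stage E)) (−0 _) (⊑-antisym p q))
             , (λ d → ∈⇒⊑ (subst (set (stage E)) (sym (−0 _)) d) , ∈⇒⊒ (subst (set (stage E)) (sym (−0 _)) d)))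
      (det-join ⇔-conj (det-holds ≤0 E u) (det-holds 0≤ E u))
      where open Quotient (set (stage E)) (isConvex (stage E))

    −∈Zero : ∀ a b → Zero (a − b) ⇔ a ≡ b
    −∈Zero a b = (λ eq → trans (solve 2 (λ a b → a ⊜ (a :- b) :+ b) refl a b) (trans (cong (_+ b) eq) (+-identityˡ b)))
               , (λ eq → trans (cong (_− b) eq) (+-inverseʳ b))

    −⊑0 : ∀ a b → QLe G Zero (a − b) 0# ⇔ a ≤ b
    −⊑0 a b = (λ { (inj₁ h) → ≤-shift h (solve 2 (λ a b → :0 :- (a :- b) ⊜ b :- a) refl a b)
                 ; (inj₂ eq) → ≤-reflexive (proj₁ (−∈Zero a b) (trans (sym (−0 (a − b))) eq)) })
            , (λ h → inj₁ (≤-shift h (solve 2 (λ a b → b :- a ⊜ :0 :- (a :- b)) refl a b)))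

    qf⇒determined : ∀ {n} {φ : Formula G (suc n)} → QF G φ → Determined (λ x v → Sat φ (extend G x v))
    qf⇒determined (qf-≈ t s) = det-⇔ (λ x v → −∈Zero (eval t (extend G x v)) (eval s (extend G x v)))
      (det-∈ zeroStage (plus t (neg s)))
    qf⇒determined (qf-≤ t s) = det-⇔ (λ x v → −⊑0 (eval t (extend G x v)) (eval s (extend G x v)))
      (det-holds ≤0 zeroStage (plus t (neg s)))
    qf⇒determined (qf-mΔ i t s) = det-∈ (rjStage i) (plus t (neg s))
    qf⇒determined (qf-mP (p , pp , m , m≥1 , Δ , r) t s) = det-⇔
      (λ x v → ⇔-sym (modP-⇔ (p ^ m) _))
      (det-holds (modulo (p ^ m) {{ℕₚ.m^n≢0 p m {{prime⇒nonZero pp}}}})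
        (rjStage (Δ , p , ℕ.nonTrivial⇒n>1 p {{prime⇒nonTrivial pp}} , r)) (plus t (neg s)))
    qf⇒determined qf-⊥ = [] , λ _ _ _ _ _ → ⇔-refl
    qf⇒determined (qf-⇒ p q) = det-join
      (λ (f , g) (h , k) → (λ i y → h (i (g y))) , (λ i y → k (i (f y)))) (qf⇒determined p) (qf⇒determined q)
    qf⇒determined (qf-∧ p q) = det-join ⇔-conj (qf⇒determined p) (qf⇒determined q)
    qf⇒determined (qf-∨ p q) = det-join
      (λ (f , g) (h , k) → (λ { (inj₁ y) → inj₁ (f y) ; (inj₂ y) → inj₂ (h y) })
                         , (λ { (inj₁ y) → inj₁ (g y) ; (inj₂ y) → inj₂ (k y) })) (qf⇒determined p) (qf⇒determined q)

    -- Eliminating an existential quantifier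

    -- The factor that raises the coefficient m to N. A condition with m = 0 is left as it is, by
    -- the factor 1.
    cofactor : ℕ → ℕ → ℕ
    cofactor N zero = 1
    cofactor N m@(suc _) = N / m

    cofactor-spec : ∀ {N m} → (m ≢ 0 → m ∣ N) → m ≡ 0 ⊎ cofactor N m ℕ.* m ≡ N
    cofactor-spec {N} {zero} _ = inj₁ refl
    cofactor-spec {N} {suc m} d = inj₂ (m/n*n≡m (d λ ()))

    cofactor-nonZero : ∀ {N} → .{{NonZero N}} → ∀ {m} → (m ≢ 0 → m ∣ N) → NonZero (cofactor N m)
    cofactor-nonZero {m = zero} _ = _
    cofactor-nonZero {N} {m = suc m} d = ℕₚ.m*n≢0⇒m≢0 (N / suc m) {suc m} {{subst NonZero (sym (m/n*n≡m (d λ ())))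
        (ℕ.≢-nonZero (ℕ.≢-nonZero⁻¹ N))}}

    modulus : Kind → ℕ
    modulus ≤0 = 1
    modulus 0≤ = 1
    modulus (modulo q) = q

    modulus-nonZero : ∀ κ → NonZero (modulus κ)
    modulus-nonZero ≤0 = _
    modulus-nonZero 0≤ = _
    modulus-nonZero (modulo q) = ℕ.≢-nonZero (ℕ.≢-nonZero⁻¹ q)

    -- In use y is m x and k the cofactor of m: multiplication by k compares N x with the point -k s
    -- and turns the modulus q into kq, which `Pat` covers as a divisor of Q.
    holds-transfer : ∀ {r} {t t′ : Fin r → Carrier} {Q D} (cD : Convex D) κ k → .{{NonZero k}} → k ℕ.* modulus κ ∣ Q →
      ∀ {y s y′ s′} b → t b ≡ - (k ⊙ s) → t′ b ≡ - (k ⊙ s′) →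
      Pattern.Pat t t′ Q D cD (k ⊙ y) (k ⊙ y′) → holds κ D (y + s) ⇔ holds κ D (y′ + s′)
    holds-transfer {t = t} {t′} {Q} {D} cD κ k d {y} {s} {y′} {s′} b tb t′b pat = go κ d
      where
      open Quotient D cD
      scaled : ∀ y s {τ} → τ ≡ - (k ⊙ s) → k ⊙ (y + s) ≡ k ⊙ y − τ
      scaled y s eq = trans (⊙-+ k y s) (trans (cong (k ⊙ y +_) (sym (-‿invol (k ⊙ s)))) (cong (k ⊙ y −_) (sym eq)))
      ≤0-⇔ : ∀ y s {τ} → τ ≡ - (k ⊙ s) → (y + s ⊑ 0#) ⇔ (k ⊙ y ⊑ τ)
      ≤0-⇔ y s {τ} eq = ⇔-trans (⊑-⊙-⇔ k) (subst (λ z → (k ⊙ (y + s) ⊑ z) ⇔ (k ⊙ y ⊑ τ)) (sym (⊙-0 k))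
        (subst (λ z → (z ⊑ 0#) ⇔ (k ⊙ y ⊑ τ)) (sym (scaled y s eq))
          ( (λ h → ⊑-shift h (solve 2 (λ a b → :0 :- (a :- b) ⊜ b :- a) refl (k ⊙ y) τ))
          , (λ h → ⊑-shift h (solve 2 (λ a b → b :- a ⊜ :0 :- (a :- b)) refl (k ⊙ y) τ)))))
      0≤-⇔ : ∀ y s {τ} → τ ≡ - (k ⊙ s) → (0# ⊑ y + s) ⇔ (τ ⊑ k ⊙ y)
      0≤-⇔ y s {τ} eq = ⇔-trans (⊑-⊙-⇔ k) (subst (λ z → (z ⊑ k ⊙ (y + s)) ⇔ (τ ⊑ k ⊙ y)) (sym (⊙-0 k))
        (subst (λ z → (0# ⊑ z) ⇔ (τ ⊑ k ⊙ y)) (sym (scaled y s eq))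
          ( (λ h → ⊑-shift h (solve 2 (λ a b → (a :- b) :- :0 ⊜ a :- b) refl (k ⊙ y) τ))
          , (λ h → ⊑-shift h (solve 2 (λ a b → a :- b ⊜ (a :- b) :- :0) refl (k ⊙ y) τ)))))
      modulo-⇔ : ∀ q y s {τ} → τ ≡ - (k ⊙ s) → CG D q (y + s) ⇔ CG D (k ℕ.* q) (k ⊙ y − τ)
      modulo-⇔ q y s {τ} eq = subst (λ z → CG D q (y + s) ⇔ CG D (k ℕ.* q) z) (scaled y s eq) (CG-scale k)
      go : ∀ κ → k ℕ.* modulus κ ∣ Q → holds κ D (y + s) ⇔ holds κ D (y′ + s′)
      go ≤0 _ = ⇔-trans (≤0-⇔ y s tb) (⇔-trans (proj₁ (proj₁ (pat b))) (⇔-sym (≤0-⇔ y′ s′ t′b)))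
      go 0≤ _ = ⇔-trans (0≤-⇔ y s tb) (⇔-trans (proj₂ (proj₁ (pat b))) (⇔-sym (0≤-⇔ y′ s′ t′b)))
      go (modulo q) d = ⇔-trans (modulo-⇔ q y s tb) (⇔-trans (proj₂ (pat b) _ d) (⇔-sym (modulo-⇔ q y′ s′ t′b)))

    module _ {n r : ℕ} (T : Fin r → Term G n) (Q : ℕ) .{{_ : NonZero Q}} where

      TPat : DefStage → Term G n → Env n → Env n → Set
      TPat E u v v′ = Pattern.Pat (λ b → eval (T b) v) (λ b → eval (T b) v′) Q
        (set (stage E)) (isConvex (stage E)) (eval u v) (eval u v′)

      ctl-Pat : ∀ E u → Controlled (TPat E u)
      ctl-Pat E u = ctl-Fin r λ b → ctl-×
        (ctl-× (ctl-def (def-⊑ E u (T b))) (ctl-def (def-⊑ E (T b) u)))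
        (ctl-map (λ v v′ f q q∣Q → f q (∣⇒≤ q∣Q) q∣Q) (ctl-≤ Q (divisor b)))
        where
        divisor : ∀ b q → Controlled (λ v v′ → q ∣ Q →
          CG (set (stage E)) q (eval u v − eval (T b) v) ⇔ CG (set (stage E)) q (eval u v′ − eval (T b) v′))
        divisor b q with q ∣? Q
        ... | no q∤Q = ctl-true λ _ _ q∣Q → contradiction q∣Q q∤Q
        ... | yes q∣Q = ctl-map (λ v v′ h _ → h)
                (ctl-def (def-CG (set (stage E)) (isConvex (stage E)) q
                  {{ℕ.≢-nonZero λ { refl → ℕ.≢-nonZero⁻¹ Q (0∣⇒≡0 q∣Q) }}} (plus u (neg (T b)))))

    module Witness {n : ℕ} (L : List (Condition n))
      (N : ℕ) .{{_ : NonZero N}} (coefficient∣N : ∀ {α} → α ∈ L → coefficient α ≢ 0 → coefficient α ∣ N)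
      (Q : ℕ) .{{_ : NonZero Q}} (N∣Q : N ∣ Q)
      (modulus∣Q : ∀ {α} → α ∈ L → cofactor N (coefficient α) ℕ.* modulus (kind α) ∣ Q) where

      k : Condition n → ℕ
      k α = cofactor N (coefficient α)

      k≢0 : ∀ {α} → α ∈ L → NonZero (k α)
      k≢0 m = cofactor-nonZero (coefficient∣N m)

      base : Condition n → Term G n
      base α = neg (k α ⊙ᵗ rest α)

      -- The point 0 is added for the divisibility by N in `root` and for conditions with
      -- coefficient 0.
      bases : List (Term G n)
      bases = zer ∷ map base L

      T : Fin (length bases) → Term G n
      T = lookup bases

      index : ∀ {α} → α ∈ L → Σ (Fin (length bases)) λ b → base α ≡ T b
      index m = fs (Any.index (∈-map⁺ base m)) , Anyₚ.lookup-index (∈-map⁺ base m)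

      defStages : List DefStage
      defStages = zeroStage ∷ map on L ++ stagesBelow (suc Q)

      on∈ : ∀ {α} → α ∈ L → on α ∈ defStages
      on∈ m = there (∈-++⁺ˡ (∈-map⁺ on m))

      stages : List Stage
      stages = map stage defStages

      complete : ∀ p → Prime p → p ∣ Q → ∀ h → h ≢ 0# → Any (λ E → _≐_ G (A p h) (set E)) stages
      complete p pp p∣Q h h≢0 = represented defStages (there (Anyₚ.++⁺ʳ (map on L)
        (stagesBelow-complete (ℕ.s≤s (∣⇒≤ p∣Q)) pp {A p h} (A-RJ p h≢0))))
        where
        represented : ∀ Es → Any (Represents (A p h)) Es → Any (λ E → _≐_ G (A p h) (set E)) (map stage Es)
        represented (E ∷ Es) (here eq) = here eq
        represented (E ∷ Es) (there m) = there (represented Es m)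

      Agreement : Env n → Env n → Set₁
      Agreement v v′ =
        (∀ {E} → E ∈ defStages → ∀ a → TPat T Q E (T a) v v′) ×
        (∀ {E} → E ∈ defStages → ∀ {F} → F ∈ defStages → ∀ b c → c ℕ.≤ Q → TPat T Q E
            (plus (T b) (c ⊙ᵗ unitTerm F)) v v′)

      agreement : Controlled Agreement
      agreement = ctl-×
        (ctl-∈ defStages λ E → ctl-Fin _ λ a → ctl-Pat T Q E (T a))
        (ctl-∈ defStages λ E → ctl-∈ defStages λ F → ctl-Fin _ λ b → ctl-≤ Q λ c → ctl-Pat T Q E
            (plus (T b) (c ⊙ᵗ unitTerm F)))

      module Transfer (v v′ : Env n) (ag : Agreement v v′) (x : Carrier) where
        t t′ : Fin (length bases) → Carrier
        t b = eval (T b) v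
        t′ b = eval (T b) v′

        open Descent t t′ Q stages complete using (LPat; transfer)

        agree : ∀ {E} → E ∈ stages → ∀ a → LPat E (t a) (t′ a)
        agree m a with ∈-map⁻ stage m
        ... | E , m′ , refl = proj₁ ag m′ a

        multiples : ∀ {E F} → E ∈ stages → F ∈ stages → ∀ b c → c ℕ.≤ Q →
          LPat E (t b + c ⊙ unit F) (t′ b + c ⊙ unit F)
        multiples m m′ b c c≤Q with ∈-map⁻ stage m | ∈-map⁻ stage m′
        ... | E , E∈ , refl | F , F∈ , refl = subst₂ (LPat (stage E))
                (cong (t b +_) (multiple v)) (cong (t′ b +_) (multiple v′)) (proj₂ ag E∈ F∈ b c c≤Q)
          where
          multiple : ∀ v → eval (c ⊙ᵗ unitTerm F) v ≡ c ⊙ unit (stage F)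
          multiple v = trans (eval-⊙ᵗ c (unitTerm F) v) (cong (c ⊙_) (unitEval F v))

        matched : ∃[ X ] (∀ {E} → E ∈ stages → LPat E (N ⊙ x) X)
        matched = transfer agree multiples (N ⊙ x)

        -- N x is divisible by N; the pattern at the subgroup {0}, for the point 0 and q = N,
        -- transfers this to X.
        root : ∃[ x′ ] (∀ {E} → E ∈ stages → LPat E (N ⊙ x) (N ⊙ x′))
        root = divide matched
          where
          divide : ∃[ X ] (∀ {E} → E ∈ stages → LPat E (N ⊙ x) X) → ∃[ x′ ] (∀ {E} → E ∈ stages →
              LPat E (N ⊙ x) (N ⊙ x′))
          divide (X , pats) = x′ , λ {E} m → subst (LPat E (N ⊙ x)) X≡ (pats m)
            where
            quotient-X : CG Zero N (X − 0#)
            quotient-X = proj₁ (proj₂ (pats (here refl) fz) N N∣Q)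
              (x , trans (cong (_− N ⊙ x) (−0 (N ⊙ x))) (+-inverseʳ (N ⊙ x)))
            x′ : Carrier
            x′ = CG.multiplier quotient-X
            X≡ : X ≡ N ⊙ x′
            X≡ = trans (sym (−0 X)) (proj₁ (−∈Zero (X − 0#) (N ⊙ x′)) (CG.remainder quotient-X))

        conditions : ∃[ x′ ] (∀ {α} → α ∈ L → ⟦ α ⟧ x v ⇔ ⟦ α ⟧ x′ v′)
        conditions = let (x′ , pats) = root in x′ , λ m → transferred x′ pats m
          where
          transferred : ∀ x′ → (∀ {E} → E ∈ stages → LPat E (N ⊙ x) (N ⊙ x′)) → ∀ {α} → α ∈ L → ⟦ α ⟧ x v ⇔ ⟦ α ⟧ x′ v′
          transferred x′ pats {α} m = holds-transfer (isConvex (stage (on α))) (kind α) (k α) {{k≢0 m}} (modulus∣Q m)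
              (proj₁ (index m)) (value v) (value v′) (pattern′ (cofactor-spec (coefficient∣N m)))
            where
            value : ∀ v → eval (T (proj₁ (index m))) v ≡ - (k α ⊙ eval (rest α) v)
            value v = trans (cong (λ u → eval u v) (sym (proj₂ (index m)))) (cong -_ (eval-⊙ᵗ (k α) (rest α) v))
            pattern′ : coefficient α ≡ 0 ⊎ k α ℕ.* coefficient α ≡ N →
              LPat (stage (on α)) (k α ⊙ (coefficient α ⊙ x)) (k α ⊙ (coefficient α ⊙ x′))
            -- With coefficient 0 the scaled left side is the point 0, whose pattern belongs to the
            -- agreement of the points among themselves.
            pattern′ (inj₁ c≡0) = subst₂ (LPat (stage (on α))) (vanish x) (vanish x′) (agree (∈-map⁺ stage (on∈ m)) fz)
              where
              vanish : ∀ x → 0# ≡ k α ⊙ (coefficient α ⊙ x)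
              vanish x = sym (trans (cong (λ c → k α ⊙ (c ⊙ x)) c≡0) (⊙-0 (k α)))
            pattern′ (inj₂ kc≡N) = subst₂ (LPat (stage (on α))) (scale x) (scale x′) (pats (∈-map⁺ stage (on∈ m)))
              where
              scale : ∀ x → N ⊙ x ≡ k α ⊙ (coefficient α ⊙ x)
              scale x = trans (cong (_⊙ x) (sym kc≡N)) (*-⊙ (k α) (coefficient α) x)

      ctl-witness : Controlled (λ v v′ → ∀ x → ∃[ x′ ] (∀ {α} → α ∈ L → ⟦ α ⟧ x v ⇔ ⟦ α ⟧ x′ v′))
      ctl-witness = ctl-map (λ v v′ ag x → Transfer.conditions v v′ ag x) agreement

    ctl-witness : ∀ {n} (L : List (Condition n)) →
      Controlled (λ v v′ → ∀ x → ∃[ x′ ] (∀ {α} → α ∈ L → ⟦ α ⟧ x v ⇔ ⟦ α ⟧ x′ v′))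
    ctl-witness L with commonMultiple (map coefficient L)
    ... | N , N≢0 , c∣N with commonMultiple (N ∷ map (λ α → cofactor N (coefficient α) ℕ.* modulus (kind α)) L)
    ...   | Q , Q≢0 , N∣Q ∷ m∣Q = Witness.ctl-witness L N {{N≢0}} coefficient∣N Q {{Q≢0}}
              (N∣Q (ℕ.≢-nonZero⁻¹ N {{N≢0}}))
              (λ {α} m → All.lookup m∣Q (∈-map⁺ _ m)
                (ℕ.≢-nonZero⁻¹ _ {{ℕₚ.m*n≢0 _ _ {{cofactor-nonZero {{N≢0}} (coefficient∣N m)}} {{modulus-nonZero
                    (kind α)}}}}))
      where
      coefficient∣N : ∀ {α} → α ∈ L → coefficient α ≢ 0 → coefficient α ∣ N
      coefficient∣N m = All.lookup c∣N (∈-map⁺ coefficient m)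

    -- Induction on formulas

    def-∃ : ∀ {n} {P : Carrier → Env n → Set} → Determined P → Definable (λ v → ∃[ x ] P x v)
    def-∃ (L , h) = controlled⇒definable (ctl-map
      (λ v v′ w (x , p) → let (x′ , a) = w x in x′ , proj₁ (h x v x′ v′ a) p) (ctl-witness L))

    def-formula : ∀ {n} (φ : Formula G n) → Definable (Sat φ)
    def-formula (t ≈ᶠ s) = def-atom _ (qf-≈ t s)
    def-formula (t ≤ᶠ s) = def-atom _ (qf-≤ t s)
    def-formula (modΔ i t s) = def-atom _ (qf-mΔ i t s)
    def-formula (modP i t s) = def-atom _ (qf-mP i t s)
    def-formula ⊥ᶠ = def-⊥
    def-formula (φ ⇒ᶠ χ) = def-⇒ (def-formula φ) (def-formula χ)
    def-formula (φ ∧ᶠ χ) = def-∧ (def-formula φ) (def-formula χ)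
    def-formula (φ ∨ᶠ χ) = def-∨ (def-formula φ) (def-formula χ)
    def-formula (∃ᶠ φ) with def-formula φ
    ... | ψ , qf , iff = def-⇔ (λ v → (λ (x , s) → x , proj₁ (iff _) s) , (λ (x , s) → x , proj₂ (iff _) s))
            (def-∃ (qf⇒determined qf))
    def-formula (∀ᶠ φ) with def-¬ (def-formula φ)
    ... | ψ , qf , iff = def-⇔
            (λ v → (λ h x → byContradiction λ n → h (x , proj₂ (iff _) n)) , (λ h (x , s) → proj₁ (iff _) s (h x)))
            (def-¬ (def-∃ (qf⇒determined qf)))

    quantifierElimination : QE G oneI
    quantifierElimination n φ = let (ψ , qf , iff) = def-formula φ in ψ , qf , λ v → ⇔-sym (iff v)

theorem2p4 : ExcludedMiddle (lsuc 0ℓ) → (G : OAG) → BoundedRegularRank G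
    → (oneI : ConstIx G → OAG.Carrier G)
    → (∀ c → IsLeastPos G (proj₁ c) (oneI c))
    → QE G oneI
theorem2p4 em G bounded oneI leastOne = Elimination.quantifierElimination em G bounded oneI leastOne
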